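{- Let $\mathcal{X},\mathcal{Y},\mathcal{Z}$ be non-empty finite sets. For any relation $f:\mathcal{X}\times\mathcal{Y}\rightarrow 2^{\mathcal{Z}}$ and any error function $\mathscr{E}:\mathcal{X}\times\mathcal{Y}\rightarrow[0,1]$, $$\mathrm{p}IC_\infty(f,\mathscr{E}) = \log \mathrm{prt}(f,\mathscr{E}),$$ where $\mathrm{p}IC_\infty$ is the pseudotranscript version of Rényi information complexity and $\mathrm{prt}$ is the partition complexity, as defined in the context.
   Context: All logarithms are to base 2. An infimum or minimum over an empty set is $+\infty$, and $\log(+\infty)=+\infty$. Inequalities between functions on $\mathcal{X}\times\mathcal{Y}$ are pointwise. **Pseudotranscripts.** A pseudotranscript $Q$ is a random variable on a discrete (finite or countable) alphabet $\mathcal{Q}$, jointly distributed with the inputs $(X,Y)\in\mathcal{X}\times\mathcal{Y}$ and specified by a conditional distribution $\mathbf{p}_{Q|X,Y}(\cdot|x,y)$ given for every $(x,y)\in\mathcal{X}\times\mathcal{Y}$, such that there exist functions $\alpha:\mathcal{Q}\times\mathcal{X}\to\mathbb{R}_{\ge 0}$ and $\beta:\mathcal{Q}\times\mathcal{Y}\to\mathbb{R}_{\ge 0}$ with $$\mathbf{p}_{Q|X,Y}(q|x,y)=\alpha(q,x)\beta(q,y)\quad\text{for all } q\in\mathcal{Q},x\in\mathcal{X},y\in\mathcal{Y}.$$ In addition, each $q\in\mathcal{Q}$ comes with an associated output $z_q\in\mathcal{Z}$. The error function of $Q$ is $\mathrm{err}_{f,Q}(x,y)=\Pr[z_Q\notin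 f(x,y)\mid (X,Y)=(x,y)]$. **Rényi mutual information of order $\infty$.** For random variables $(A,B)$ over $\mathcal{A}\times\mathcal{B}$, $$I_\infty(A;B)=\log\Big(\sum_{b\in\mathcal{B}}\ \max_{a\in\mathcal{A}:\,\mathbf{p}_A(a)>0}\mathbf{p}_{B|A}(b|a)\Big).$$ **The measure $\mathrm{p}IC_\infty$.** $$\mathrm{p}IC_\infty(f,\mathscr{E})=\inf_{\text{pseudotranscript } Q:\ \mathrm{err}_{f,Q}\le\mathscr{E}}\ \max_{\mathbf{p}_{X,Y}}\ I_\infty(X,Y;Q),$$ where the maximum is over all probability distributions $\mathbf{p}_{X,Y}$ on $\mathcal{X}\times\mathcal{Y}$ (the conditional $\mathbf{p}_{Q|X,Y}$ being fixed by $Q$). Equivalently, the inner maximum is $\log\sum_{q\in\mathcal{Q}}\max_{(x,y)\in\mathcal{X}\times\mathcal{Y}}\mathbf{p}_{Q|X,Y}(q|x,y)$. **Partition complexity.** A tile is a pair $t=(r_X\times r_Y,z)$ with $r_X\subseteq\mathcal{X}$, $r_Y\subseteq\mathcal{Y}$, $z\in\mathcal{Z}$; write $z_t=z$, and $(x,y)\in t$ iff $x\in r_X$ and $y\in r_Y$. Let $\mathcal{T}$ be the set of all tiles. Then $\mathrm{prt}(f,\mathscr{E})$ is the minimum of $\sum_{t\in\mathcal{T}}w(t)$ over all $w:\mathcal{T}\to[0,1]$ such that for all $(x,y)\in\mathcal{X}\times\mathcal{Y}$, $$\sum_{t\in\mathcal{T}:(x,y)\in t}w(t)=1\qquad\text{and}\qquad\sum_{t\in\mathcal{T}:(x,y)\in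 t,\ z_t\in f(x,y)}w(t)\ \ge\ 1-\mathscr{E}(x,y).$$ -}

module Defs where

open import Algebra.Bundles using (CommutativeRing)
open import Data.Bool.Base using (if_then_else_)
open import Data.Fin.Base using (Fin)
open import Data.Fin.Subset using (Subset; inside; outside; _∈_)
open import Data.Fin.Subset.Properties using (_∈?_)
open import Data.List.Base
  using (List; []; _∷_; _++_; map; foldr; filter; allFin; cartesianProduct)
open import Data.List.Relation.Unary.Unique.Propositional using (Unique)
open import Data.Nat.Base using (ℕ; suc)
open import Data.Product using (∃; _×_; _,_)
open import Data.Vec.Base using ([]; _∷_)
open import Function.Bundles using (_↣_)
open import Level using (Level; _⊔_; 0ℓ) renaming (suc to lsuc)
open import Relation.Binary.Bundles using (DecTotalOrder)
open import Relation.Binary.Core using (Rel)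
open import Relation.Binary.Structures using (IsDecTotalOrder)
open import Relation.Nullary.Construct.Add.Supremum using (_⁺; [_]; ⊤⁺)
open import Relation.Nullary.Decidable using (Dec; does; _×-dec_)
open import Relation.Nullary.Negation using (¬_)
import Data.List.Extrema
import Relation.Binary.Construct.Add.Supremum.Equality
import Relation.Binary.Construct.Add.Supremum.NonStrict
import Relation.Binary.Construct.NonStrictToStrict

module _ {a ℓ : Level} {A : Set a} (_≤_ : Rel A ℓ) where

  IsUpperBound : ∀ {s} → (A → Set s) → A → Set (a ⊔ ℓ ⊔ s)
  IsUpperBound S b = ∀ {x} → S x → x ≤ b

  IsLowerBound : ∀ {s} → (A → Set s) → A → Set (a ⊔ ℓ ⊔ s)
  IsLowerBound S b = ∀ {x} → S x → b ≤ x

  IsSupremum : ∀ {s} → (A → Set s) → A → Set (a ⊔ ℓ ⊔ s)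
  IsSupremum S v = IsUpperBound S v × (∀ {b} → IsUpperBound S b → v ≤ b)

  IsInfimum : ∀ {s} → (A → Set s) → A → Set (a ⊔ ℓ ⊔ s)
  IsInfimum S v = IsLowerBound S v × (∀ {b} → IsLowerBound S b → b ≤ v)

  IsGreatest : ∀ {s} → (A → Set s) → A → Set (a ⊔ ℓ ⊔ s)
  IsGreatest S v = S v × IsUpperBound S v

  IsLeast : ∀ {s} → (A → Set s) → A → Set (a ⊔ ℓ ⊔ s)
  IsLeast S v = S v × IsLowerBound S v

-- The real numbers are, classically and up to unique isomorphism, the only
-- model of these axioms. The order is decidable and suprema exist without
-- any locatedness condition, so this is the classical real line.
record CompleteOrderedField (c ℓ₁ ℓ₂ : Level) : Set (lsuc (c ⊔ ℓ₁ ⊔ ℓ₂)) where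
  field
    commutativeRing : CommutativeRing c ℓ₁

  open CommutativeRing commutativeRing public

  infix 4 _≤_

  field
    _≤_             : Rel Carrier ℓ₂
    isDecTotalOrder : IsDecTotalOrder _≈_ _≤_
    0≉1             : ¬ (0# ≈ 1#)
    inverse         : ∀ x → ¬ (x ≈ 0#) → ∃ λ y → x * y ≈ 1#
    +-monoʳ-≤       : ∀ x {y z} → y ≤ z → x + y ≤ x + z
    *-nonNeg        : ∀ {x y} → 0# ≤ x → 0# ≤ y → 0# ≤ x * y
    supremum        : (S : Carrier → Set (c ⊔ ℓ₁ ⊔ ℓ₂)) →
                      ∃ S → ∃ (IsUpperBound _≤_ S) → ∃ (IsSupremum _≤_ S)

  decTotalOrder : DecTotalOrder c ℓ₁ ℓ₂
  decTotalOrder = record { isDecTotalOrder = isDecTotalOrder }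

  open Relation.Binary.Construct.NonStrictToStrict _≈_ _≤_ public
    using (_<_; <-decidable)

  infix 4 _<?_
  _<?_ : (x y : Carrier) → Dec (x < y)
  _<?_ = <-decidable (IsDecTotalOrder._≟_ isDecTotalOrder)
                     (IsDecTotalOrder._≤?_ isDecTotalOrder)

-- On positive arguments these laws have exactly one solution, the logarithm
-- to base 2; values at other arguments are unconstrained and never used.
record IsLog₂ {c ℓ₁ ℓ₂} (ℝ : CompleteOrderedField c ℓ₁ ℓ₂)
              (log : CompleteOrderedField.Carrier ℝ → CompleteOrderedField.Carrier ℝ)
              : Set (c ⊔ ℓ₁ ⊔ ℓ₂) where
  open CompleteOrderedField ℝ
  field
    log-mono : ∀ {x y} → 0# < x → x ≤ y → log x ≤ log y
    log-*    : ∀ {x y} → 0# < x → 0# < y → log (x * y) ≈ log x + log y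
    log-2    : log (1# + 1#) ≈ 1#

subsets : ∀ n → List (Subset n)
subsets 0       = [] ∷ []
subsets (suc n) = map (outside ∷_) (subsets n) ++ map (inside ∷_) (subsets n)

-- A rectangle is kept as its pair of sides, so empty rectangles have several
-- representatives; they cover no input, and minimal weightings give them 0.
Tile : ℕ → ℕ → ℕ → Set
Tile m n k = (Subset m × Subset n) × Fin k

allTiles : ∀ m n k → List (Tile m n k)
allTiles m n k =
  cartesianProduct (cartesianProduct (subsets m) (subsets n)) (allFin k)

label : ∀ {m n k} → Tile m n k → Fin k
label (_ , z) = z

infix 4 _∈ₜ_ _∈ₜ?_

_∈ₜ_ : ∀ {m n k} → Fin m × Fin n → Tile m n k → Set
(x , y) ∈ₜ ((rX , rY) , _) = x ∈ rX × y ∈ rY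

_∈ₜ?_ : ∀ {m n k} (xy : Fin m × Fin n) (t : Tile m n k) → Dec (xy ∈ₜ t)
(x , y) ∈ₜ? ((rX , rY) , _) = (x ∈? rX) ×-dec (y ∈? rY)

inputs : ∀ m n → List (Fin m × Fin n)
inputs m n = cartesianProduct (allFin m) (allFin n)

module Complexity {c ℓ₁ ℓ₂} (ℝ : CompleteOrderedField c ℓ₁ ℓ₂)
                  (log : CompleteOrderedField.Carrier ℝ → CompleteOrderedField.Carrier ℝ)
                  where

  open CompleteOrderedField ℝ

  open Data.List.Extrema (DecTotalOrder.totalOrder decTotalOrder) public
    using (max)
  -- Carrier ⁺ is ℝ ∪ {+∞}, with ⊤⁺ as +∞.
  open Relation.Binary.Construct.Add.Supremum.Equality _≈_ public
    using (_≈⁺_)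
  open Relation.Binary.Construct.Add.Supremum.NonStrict _≤_ public
    using (_≤⁺_)

  log⁺ : Carrier ⁺ → Carrier ⁺
  log⁺ [ x ] = [ log x ]
  log⁺ ⊤⁺    = ⊤⁺

  data IsMinimum {s} (S : Carrier → Set s) : Carrier ⁺ → Set (c ⊔ ℓ₂ ⊔ s) where
    attained : ∀ {v} → IsLeast _≤_ S v → IsMinimum S [ v ]
    empty    : (∀ v → ¬ S v) → IsMinimum S ⊤⁺

  ∑ : ∀ {a} {A : Set a} → List A → (A → Carrier) → Carrier
  ∑ xs g = foldr _+_ 0# (map g xs)

  -- The sum of a family over an arbitrary discrete index type, as the
  -- supremum of its finite partial sums. Only for non-negative families.
  IsSum : {A : Set} → (A → Carrier) → Carrier ⁺ → Set (c ⊔ ℓ₁ ⊔ ℓ₂)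
  IsSum {A} g = IsSupremum _≤⁺_
    λ v → ∃ λ (as : List A) → Unique as × v ≈⁺ [ ∑ as g ]

  record Pseudotranscript (m n k : ℕ) : Set (lsuc 0ℓ ⊔ c ⊔ ℓ₁ ⊔ ℓ₂) where
    field
      Alphabet  : Set
      -- Finite or countably infinite.
      countable : Alphabet ↣ ℕ
      prob      : Alphabet → Fin m → Fin n → Carrier
      sum≡1     : ∀ x y → IsSum (λ q → prob q x y) [ 1# ]
      factors   : ∃ λ (α : Alphabet → Fin m → Carrier) →
                  ∃ λ (β : Alphabet → Fin n → Carrier) →
                    (∀ q x → 0# ≤ α q x) ×
                    (∀ q y → 0# ≤ β q y) ×
                    (∀ q x y → prob q x y ≈ α q x * β q y)
      output    : Alphabet → Fin k

  module _ {m n k : ℕ} where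

    IsError : (Fin m → Fin n → Subset k) → Pseudotranscript m n k →
              Fin m → Fin n → Carrier ⁺ → Set (c ⊔ ℓ₁ ⊔ ℓ₂)
    IsError f Q x y =
      IsSum λ q → if does (output q ∈? f x y) then 0# else prob q x y
      where open Pseudotranscript Q

    ErrorAtMost : (Fin m → Fin n → Subset k) → (Fin m → Fin n → Carrier) →
                  Pseudotranscript m n k → Set (c ⊔ ℓ₁ ⊔ ℓ₂)
    ErrorAtMost f ℰ Q = ∀ x y → ∃ λ e → IsError f Q x y e × e ≤⁺ [ ℰ x y ]

    IsDistribution : (Fin m × Fin n → Carrier) → Set (ℓ₁ ⊔ ℓ₂)
    IsDistribution p = (∀ xy → 0# ≤ p xy) × ∑ (inputs m n) p ≈ 1#

    -- The support of a distribution is non-empty and probabilities are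
    -- non-negative, so starting the maximum at 0# does not affect it.
    maxOverSupport : (Fin m × Fin n → Carrier) → (Q : Pseudotranscript m n k) →
                     Pseudotranscript.Alphabet Q → Carrier
    maxOverSupport p Q q =
      max 0# (map (λ (x , y) → Pseudotranscript.prob Q q x y)
                  (filter (λ xy → 0# <? p xy) (inputs m n)))

    -- I∞(X,Y;Q) = v when (X,Y) is distributed as p.
    IsI∞ : (Fin m × Fin n → Carrier) → Pseudotranscript m n k →
           Carrier ⁺ → Set (c ⊔ ℓ₁ ⊔ ℓ₂)
    IsI∞ p Q v = ∃ λ s → IsSum (maxOverSupport p Q) s × v ≈⁺ log⁺ s

    IsMaxI∞ : Pseudotranscript m n k → Carrier ⁺ → Set (c ⊔ ℓ₁ ⊔ ℓ₂)
    IsMaxI∞ Q = IsGreatest _≤⁺_ λ v → ∃ λ p → IsDistribution p × IsI∞ p Q v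

    IsPIC∞ : (Fin m → Fin n → Subset k) → (Fin m → Fin n → Carrier) →
             Carrier ⁺ → Set (lsuc 0ℓ ⊔ c ⊔ ℓ₁ ⊔ ℓ₂)
    IsPIC∞ f ℰ = IsInfimum _≤⁺_ λ v → ∃ λ Q → ErrorAtMost f ℰ Q × IsMaxI∞ Q v

    record IsFractionalPartition (f : Fin m → Fin n → Subset k)
                                 (ℰ : Fin m → Fin n → Carrier)
                                 (w : Tile m n k → Carrier)
                                 : Set (ℓ₁ ⊔ ℓ₂) where
      field
        nonNeg : ∀ t → 0# ≤ w t
        ≤1     : ∀ t → w t ≤ 1#
        cover  : ∀ x y → ∑ (filter ((x , y) ∈ₜ?_) (allTiles m n k)) w ≈ 1#
        error  : ∀ x y →
                 1# - ℰ x y ≤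
                 ∑ (filter (λ t → ((x , y) ∈ₜ? t) ×-dec (label t ∈? f x y))
                           (allTiles m n k)) w

    IsPrt : (Fin m → Fin n → Subset k) → (Fin m → Fin n → Carrier) →
            Carrier ⁺ → Set (c ⊔ ℓ₁ ⊔ ℓ₂)
    IsPrt f ℰ = IsMinimum λ v → ∃ λ w →
      IsFractionalPartition f ℰ w × v ≈ ∑ (allTiles m n k) w

{-# OPTIONS --safe #-}

-- Both sides are the same optimisation problem. A fractional partition w is a
-- pseudotranscript whose alphabet is the set of tiles: given (x,y), tile t has
-- probability w(t) if (x,y) ∈ t and 0 otherwise. Conversely, write a symbol q
-- as α(x)β(y) = M a(x)b(y) with a, b ≤ 1 and M = max α · max β = max p(q|x,y).
-- Drawing the two sides of a rectangle by including every x and y independently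
-- with probabilities a(x) and b(y) spreads the weight M over tiles labelled z_q
-- so that those containing (x,y) receive p(q|x,y). Summing over q gives a
-- fractional partition of total weight Σ_q max p(q|x,y).
--
-- The minimum defining prt is found by Fourier–Motzkin elimination, which over a
-- decidable field either produces an optimal w or shows that there is none.
module Submission where

open import Defs
open import Data.Bool.Base using (Bool; true; false; _∧_; if_then_else_)
import Data.Bool.Properties as Bool
open import Data.Fin.Base using (Fin; zero; suc; toℕ; fromℕ<)
import Data.Fin.Properties as Fin
open import Data.Fin.Subset using (Subset; inside; outside)
open import Data.Fin.Subset.Properties using (_∈?_)
open import Data.List.Base
  using (List; []; _∷_; _++_; map; filter; lookup; allFin; cartesianProduct; cartesianProductWith)
import Data.List.Extrema
import Data.List.Membership.DecPropositional as DecMembership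
open import Data.List.Membership.Propositional using (_∈_)
open import Data.List.Membership.Propositional.Properties
  using ( ∈-++⁺ˡ; ∈-++⁺ʳ; ∈-++⁻; ∈-∃++; ∈-map⁺; ∈-map⁻; ∈-filter⁺; ∈-filter⁻; ∈-allFin
        ; ∈-cartesianProduct⁺; ∈-cartesianProductWith⁺; ∈-cartesianProductWith⁻)
open import Data.List.Relation.Unary.All as All using (All; []; _∷_)
import Data.List.Relation.Unary.All.Properties as All
open import Data.List.Relation.Unary.Any using (here; there; index)
import Data.List.Relation.Unary.Any.Properties as Any
open import Data.List.Relation.Unary.Unique.Propositional using (Unique; []; _∷_)
import Data.List.Relation.Unary.Unique.Propositional.Properties as Unique
open import Data.Nat.Base using (ℕ; suc; NonZero; >-nonZero⁻¹)
import Data.Nat.Properties as ℕ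
open import Data.Product as Product using (∃; ∃₂; _×_; _,_; proj₁; proj₂)
import Data.Product.Properties as ×
open import Data.Sum.Base as Sum using (_⊎_; inj₁; inj₂)
open import Data.Vec.Base using ([]; _∷_)
import Data.Vec.Properties as Vec
open import Function.Base using (id; _∘_)
open import Function.Bundles using (_↣_; mk↣)
open import Level using (Level; _⊔_; Lift; lift)
open import Relation.Binary.Bundles using (DecTotalOrder)
open import Relation.Binary.Definitions using (DecidableEquality)
open import Relation.Binary.PropositionalEquality.Core
  using (_≡_; _≢_; cong) renaming (refl to ≡-refl; sym to ≡-sym; trans to ≡-trans)
open import Relation.Nullary.Construct.Add.Supremum using ([_]; ⊤⁺)
open import Relation.Nullary.Decidable using (Dec; yes; no; does; ¬?; _×-dec_; via-injection)
open import Relation.Nullary.Negation using (¬_; contradiction)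
open import Relation.Unary using (Pred; Decidable)
import Algebra.Construct.NaturalChoice.Min
import Algebra.Properties.Ring
import Algebra.Solver.Ring.NaturalCoefficients.Default
import Relation.Binary.Construct.Add.Supremum.Equality
import Relation.Binary.Construct.Add.Supremum.NonStrict
import Relation.Binary.Reasoning.PartialOrder
import Relation.Binary.Reasoning.Setoid

-- A pseudotranscript may have an infinite alphabet, so the weight that rounding gives a tile is a
-- series over symbols, and each constraint on a partition asks to exchange a finite sum over tiles
-- with such series. Convergence comes from the finiteness of the input set: the largest probability
-- of a symbol is at most the sum of its probabilities over all inputs, so the peaks total at most
-- the number of inputs. `IsPrt` asks for an attained minimum. Elimination keeps the objective value
-- `v` as a parameter to the end, and the attainment is then that of a linear problem in one
-- variable. The inner maximum over distributions is reached at any distribution of full support;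
-- the uniform one is taken. Monotonicity of `log` is available only from positive arguments on;
-- every total met is at least 1, because it dominates the total for one single input. There may be
-- no partition at all, for instance if `f x y` is empty and `ℰ x y < 1`; then both sides are `⊤⁺`.

-- Enumeration of subsets, tiles and inputs

subsets-complete : ∀ {n} (S : Subset n) → S ∈ subsets n
subsets-complete []            = here ≡-refl
subsets-complete {suc n} (outside ∷ S) = ∈-++⁺ˡ (∈-map⁺ (outside ∷_) (subsets-complete S))
subsets-complete {suc n} (inside ∷ S)  =
  ∈-++⁺ʳ (map (outside ∷_) (subsets n)) (∈-map⁺ (inside ∷_) (subsets-complete S))

subsets-unique : ∀ n → Unique (subsets n)
subsets-unique 0       = [] ∷ []
subsets-unique (suc n) =
  Unique.++⁺ (Unique.map⁺ Vec.∷-injectiveʳ (subsets-unique n))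
             (Unique.map⁺ Vec.∷-injectiveʳ (subsets-unique n)) disjoint
  where
  disjoint : ∀ {S} → ¬ (S ∈ map (outside ∷_) (subsets n) × S ∈ map (inside ∷_) (subsets n))
  disjoint (S∈out , S∈in) with ∈-map⁻ (outside ∷_) S∈out | ∈-map⁻ (inside ∷_) S∈in
  ... | _ , _ , ≡-refl | _ , _ , ()

allTiles-complete : ∀ {m n k} (t : Tile m n k) → t ∈ allTiles m n k
allTiles-complete ((X , Y) , z) =
  ∈-cartesianProduct⁺ (∈-cartesianProduct⁺ (subsets-complete X) (subsets-complete Y)) (∈-allFin z)

allTiles-unique : ∀ m n k → Unique (allTiles m n k)
allTiles-unique m n k =
  Unique.cartesianProduct⁺ (Unique.cartesianProduct⁺ (subsets-unique m) (subsets-unique n))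
                          (Unique.allFin⁺ k)

infix 4 _≟ₜ_
_≟ₜ_ : ∀ {m n k} → DecidableEquality (Tile m n k)
_≟ₜ_ = ×.≡-dec (×.≡-dec (Vec.≡-dec Bool._≟_) (Vec.≡-dec Bool._≟_)) Fin._≟_

tile↣ℕ : ∀ {m n k} → Tile m n k ↣ ℕ
tile↣ℕ {m} {n} {k} = mk↣ {to = λ t → toℕ (index (allTiles-complete t))} λ {s} {t} eq →
  ≡-trans (Any.lookup-index (allTiles-complete s))
    (≡-trans (cong (lookup (allTiles m n k)) (Fin.toℕ-injective eq))
       (≡-sym (Any.lookup-index (allTiles-complete t))))

inputs-complete : ∀ {m n} (xy : Fin m × Fin n) → xy ∈ inputs m n
inputs-complete (x , y) = ∈-cartesianProduct⁺ (∈-allFin x) (∈-allFin y)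

-- Arithmetic of an ordered field

module OrderedField {c ℓ₁ ℓ₂} (ℝ : CompleteOrderedField c ℓ₁ ℓ₂)
                    (log : CompleteOrderedField.Carrier ℝ → CompleteOrderedField.Carrier ℝ)
                    where

  open CompleteOrderedField ℝ public hiding (zero)
  open Complexity ℝ log public
  open DecTotalOrder decTotalOrder public
    using (poset; _≤?_; _≟_; total; antisym)
    renaming (refl to ≤-refl; reflexive to ≤-reflexive; trans to ≤-trans)
  open Algebra.Properties.Ring ring public
  module Solver = Algebra.Solver.Ring.NaturalCoefficients.Default commutativeSemiring
  open Solver using (solve; _:=_; _:+_; _:*_)
  module ≈-Reasoning = Relation.Binary.Reasoning.Setoid setoid
  module ≤-Reasoning = Relation.Binary.Reasoning.PartialOrder poset

  ≰⇒≥ : ∀ {x y} → ¬ (x ≤ y) → y ≤ x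
  ≰⇒≥ {x} {y} x≰y with total x y
  ... | inj₁ x≤y = contradiction x≤y x≰y
  ... | inj₂ y≤x = y≤x

  ≰⇒> : ∀ {x y} → ¬ (x ≤ y) → y < x
  ≰⇒> x≰y = ≰⇒≥ x≰y , λ y≈x → x≰y (≤-reflexive (sym y≈x))

  ≮⇒≥ : ∀ {x y} → ¬ (x < y) → y ≤ x
  ≮⇒≥ {x} {y} x≮y with y ≤? x
  ... | yes y≤x = y≤x
  ... | no  y≰x = contradiction (≰⇒> y≰x) x≮y

  <-≤-trans : ∀ {x y z} → x < y → y ≤ z → x < z
  <-≤-trans (x≤y , x≉y) y≤z =
    ≤-trans x≤y y≤z ,
    λ x≈z → x≉y (antisym x≤y (≤-trans y≤z (≤-reflexive (sym x≈z))))

  +-mono-≤ : ∀ {x y u v} → x ≤ y → u ≤ v → x + u ≤ y + v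
  +-mono-≤ {x} {y} {u} {v} x≤y u≤v = begin
    x + u ≤⟨ +-monoʳ-≤ x u≤v ⟩
    x + v ≈⟨ +-comm x v ⟩
    v + x ≤⟨ +-monoʳ-≤ v x≤y ⟩
    v + y ≈⟨ +-comm v y ⟩
    y + v ∎
    where open ≤-Reasoning

  +-nonNeg : ∀ {x y} → 0# ≤ x → 0# ≤ y → 0# ≤ x + y
  +-nonNeg 0≤x 0≤y = ≤-trans (≤-reflexive (sym (+-identityˡ 0#))) (+-mono-≤ 0≤x 0≤y)

  x+[y-x]≈y : ∀ x y → x + (y - x) ≈ y
  x+[y-x]≈y x y = begin
    x + (y - x)   ≈⟨ solve 3 (λ x y n → x :+ (y :+ n) := y :+ (x :+ n)) refl x y (- x) ⟩
    y + (x - x)   ≈⟨ +-congˡ (-‿inverseʳ x) ⟩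
    y + 0#        ≈⟨ +-identityʳ y ⟩
    y             ∎
    where open ≈-Reasoning

  ≤⇒0≤- : ∀ {x y} → x ≤ y → 0# ≤ y - x
  ≤⇒0≤- {x} {y} x≤y = begin
    0#      ≈⟨ -‿inverseˡ x ⟨
    - x + x ≤⟨ +-monoʳ-≤ (- x) x≤y ⟩
    - x + y ≈⟨ +-comm (- x) y ⟩
    y - x   ∎
    where open ≤-Reasoning

  0≤-⇒≤ : ∀ {x y} → 0# ≤ y - x → x ≤ y
  0≤-⇒≤ {x} {y} 0≤y-x = begin
    x           ≈⟨ +-identityʳ x ⟨
    x + 0#      ≤⟨ +-monoʳ-≤ x 0≤y-x ⟩
    x + (y - x) ≈⟨ x+[y-x]≈y x y ⟩
    y           ∎
    where open ≤-Reasoning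

  +≤⇒≤- : ∀ {x y z} → x + y ≤ z → y ≤ z - x
  +≤⇒≤- {x} {y} {z} x+y≤z = begin
    y               ≈⟨ -x+[x+y]≈y ⟨
    - x + (x + y)   ≤⟨ +-monoʳ-≤ (- x) x+y≤z ⟩
    - x + z         ≈⟨ +-comm (- x) z ⟩
    z - x           ∎
    where
    open ≤-Reasoning
    -x+[x+y]≈y : - x + (x + y) ≈ y
    -x+[x+y]≈y = trans (sym (+-assoc (- x) x y)) (trans (+-congʳ (-‿inverseˡ x)) (+-identityˡ y))

  ≤-⇒+≤ : ∀ {x y z} → y ≤ z - x → x + y ≤ z
  ≤-⇒+≤ {x} {y} {z} y≤z-x =
    ≤-trans (+-monoʳ-≤ x y≤z-x) (≤-reflexive (x+[y-x]≈y x z))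

  *-monoˡ-≤ : ∀ {r x y} → 0# ≤ r → x ≤ y → r * x ≤ r * y
  *-monoˡ-≤ {r} {x} {y} 0≤r x≤y = begin
    r * x               ≈⟨ +-identityʳ (r * x) ⟨
    r * x + 0#          ≤⟨ +-monoʳ-≤ (r * x) (*-nonNeg 0≤r (≤⇒0≤- x≤y)) ⟩
    r * x + r * (y - x) ≈⟨ distribˡ r x (y - x) ⟨
    r * (x + (y - x))   ≈⟨ *-congˡ (x+[y-x]≈y x y) ⟩
    r * y               ∎
    where open ≤-Reasoning

  *-monoʳ-≤ : ∀ {r x y} → 0# ≤ r → x ≤ y → x * r ≤ y * r
  *-monoʳ-≤ {r} {x} {y} 0≤r x≤y = begin
    x * r ≈⟨ *-comm x r ⟩
    r * x ≤⟨ *-monoˡ-≤ 0≤r x≤y ⟩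
    r * y ≈⟨ *-comm r y ⟩
    y * r ∎
    where open ≤-Reasoning

  ≤0⇒0≤neg : ∀ {x} → x ≤ 0# → 0# ≤ - x
  ≤0⇒0≤neg x≤0 = ≤-trans (≤⇒0≤- x≤0) (≤-reflexive (+-identityˡ _))

  0≤1 : 0# ≤ 1#
  0≤1 with total 0# 1#
  ... | inj₁ 0≤1 = 0≤1
  ... | inj₂ 1≤0 = ≤-trans (*-nonNeg 0≤-1 0≤-1) (≤-reflexive (begin
    - 1# * - 1# ≈⟨ -1*x≈-x (- 1#) ⟩
    - (- 1#)    ≈⟨ -‿involutive 1# ⟩
    1#          ∎))
    where
    open ≈-Reasoning
    0≤-1 : 0# ≤ - 1#
    0≤-1 = ≤0⇒0≤neg 1≤0

  0<1 : 0# < 1#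
  0<1 = 0≤1 , 0≉1

  reciprocal : ∀ {x} → 0# < x → ∃ λ y → 0# ≤ y × x * y ≈ 1#
  reciprocal {x} (0≤x , 0≉x) with inverse x (0≉x ∘ sym)
  ... | y , xy≈1 with total 0# y
  ... | inj₁ 0≤y = y , 0≤y , xy≈1
  ... | inj₂ y≤0 = contradiction (antisym 0≤1 1≤0) 0≉1
    where
    1≤0 : 1# ≤ 0#
    1≤0 = ≤-trans (≤-reflexive (sym xy≈1))
            (≤-trans (*-monoˡ-≤ 0≤x y≤0) (≤-reflexive (zeroʳ x)))

  *-cancelˡ-nonNeg : ∀ {x y} → 0# < x → 0# ≤ x * y → 0# ≤ y
  *-cancelˡ-nonNeg {x} {y} 0<x 0≤xy with reciprocal 0<x
  ... | z , 0≤z , xz≈1 = ≤-trans (*-nonNeg 0≤z 0≤xy) (≤-reflexive (begin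
    z * (x * y) ≈⟨ solve 3 (λ x y z → z :* (x :* y) := (x :* z) :* y) refl x y z ⟩
    x * z * y   ≈⟨ *-congʳ xz≈1 ⟩
    1# * y      ≈⟨ *-identityˡ y ⟩
    y           ∎))
    where open ≈-Reasoning

  *-cancelˡ-≤ : ∀ {r x y} → 0# < r → r * x ≤ r * y → x ≤ y
  *-cancelˡ-≤ {r} {x} {y} 0<r rx≤ry = 0≤-⇒≤ (*-cancelˡ-nonNeg 0<r
    (≤-trans (≤⇒0≤- rx≤ry) (≤-reflexive (sym (x[y-z]≈xy-xz r y x)))))

  *-antimonoˡ-≤ : ∀ {r x y} → r ≤ 0# → x ≤ y → r * y ≤ r * x
  *-antimonoˡ-≤ {r} {x} {y} r≤0 x≤y = begin
    r * y                             ≈⟨ +-identityʳ _ ⟨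
    r * y + 0#                        ≤⟨ +-monoʳ-≤ _ (*-nonNeg (≤0⇒0≤neg r≤0) (≤⇒0≤- x≤y)) ⟩
    r * y + - r * (y - x)             ≈⟨ +-congʳ (*-congˡ (x+[y-x]≈y x y)) ⟨
    r * (x + (y - x)) + - r * (y - x) ≈⟨ solve 4 (λ r n x d → r :* (x :+ d) :+ n :* d :=
                                           r :* x :+ (r :+ n) :* d) refl r (- r) x (y - x) ⟩
    r * x + (r - r) * (y - x)         ≈⟨ +-congˡ (trans (*-congʳ (-‿inverseʳ r)) (zeroˡ _)) ⟩
    r * x + 0#                        ≈⟨ +-identityʳ _ ⟩
    r * x                             ∎
    where open ≤-Reasoning

  +-cancelʳ-≤ : ∀ z {x y} → x + z ≤ y + z → x ≤ y
  +-cancelʳ-≤ z {x} {y} x+z≤y+z = begin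
    x         ≤⟨ +≤⇒≤- (≤-trans (≤-reflexive (+-comm z x)) x+z≤y+z) ⟩
    y + z - z ≈⟨ //-rightDividesʳ z y ⟩
    y         ∎
    where open ≤-Reasoning

  +-cancelˡ-≤ : ∀ z {x y} → z + x ≤ z + y → x ≤ y
  +-cancelˡ-≤ z {x} {y} z+x≤z+y = ≤-trans (+≤⇒≤- z+x≤z+y) (≤-reflexive (xyx⁻¹≈y z y))

  normalise : ∀ {x M} → 0# ≤ x → x ≤ M → ∃ λ y → (0# ≤ y × y ≤ 1#) × x ≈ M * y
  normalise {x} {M} 0≤x x≤M with 0# <? M
  -- Here `0 ≤ x ≤ M ≤ 0`, so both vanish and any point of the unit interval would serve.
  ... | no  0≮M = 0# , (≤-refl , 0≤1) ,
                  trans (antisym (≤-trans x≤M (≮⇒≥ 0≮M)) 0≤x) (sym (zeroʳ M))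
  ... | yes 0<M with reciprocal 0<M
  ... | i , 0≤i , Mi≈1 = x * i , (*-nonNeg 0≤x 0≤i , ≤1′) , sym (begin
    M * (x * i) ≈⟨ solve 3 (λ M x i → M :* (x :* i) := x :* (M :* i)) refl M x i ⟩
    x * (M * i) ≈⟨ *-congˡ Mi≈1 ⟩
    x * 1#      ≈⟨ *-identityʳ x ⟩
    x           ∎)
    where
    open ≈-Reasoning
    ≤1′ : x * i ≤ 1#
    ≤1′ = ≤-trans (*-monoʳ-≤ 0≤i x≤M) (≤-reflexive Mi≈1)

  indicator : Bool → Carrier
  indicator b = if b then 1# else 0#

  indicator-nonNeg : ∀ b → 0# ≤ indicator b
  indicator-nonNeg true  = 0≤1
  indicator-nonNeg false = ≤-refl

  indicator-∧ : ∀ a b → indicator (a ∧ b) ≈ indicator a * indicator b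
  indicator-∧ true  b = sym (*-identityˡ _)
  indicator-∧ false b = sym (zeroˡ _)

  indicator*≤ : ∀ b {x} → 0# ≤ x → indicator b * x ≤ x
  indicator*≤ true  0≤x = ≤-reflexive (*-identityˡ _)
  indicator*≤ false 0≤x = ≤-trans (≤-reflexive (zeroˡ _)) 0≤x

  -- Finite sums over lists

  private variable
    a p : Level
    A B : Set a

  ∑-mono : ∀ (xs : List A) {g h} → (∀ {x} → x ∈ xs → g x ≤ h x) → ∑ xs g ≤ ∑ xs h
  ∑-mono []       g≤h = ≤-refl
  ∑-mono (x ∷ xs) g≤h = +-mono-≤ (g≤h (here ≡-refl)) (∑-mono xs (g≤h ∘ there))

  ∑-cong : ∀ (xs : List A) {g h} → (∀ {x} → x ∈ xs → g x ≈ h x) → ∑ xs g ≈ ∑ xs h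
  ∑-cong []       g≈h = refl
  ∑-cong (x ∷ xs) g≈h = +-cong (g≈h (here ≡-refl)) (∑-cong xs (g≈h ∘ there))

  ∑-zero : ∀ (xs : List A) → ∑ xs (λ _ → 0#) ≈ 0#
  ∑-zero []       = refl
  ∑-zero (x ∷ xs) = trans (+-identityˡ _) (∑-zero xs)

  ∑-nonNeg : ∀ (xs : List A) {g} → (∀ x → 0# ≤ g x) → 0# ≤ ∑ xs g
  ∑-nonNeg xs 0≤g = ≤-trans (≤-reflexive (sym (∑-zero xs))) (∑-mono xs (λ {x} _ → 0≤g x))

  ∑-+ : ∀ (xs : List A) g h → ∑ xs (λ x → g x + h x) ≈ ∑ xs g + ∑ xs h
  ∑-+ []       g h = sym (+-identityˡ 0#)
  ∑-+ (x ∷ xs) g h = trans (+-congˡ (∑-+ xs g h))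
    (solve 4 (λ a b c d → (a :+ b) :+ (c :+ d) := (a :+ c) :+ (b :+ d)) refl
       (g x) (h x) (∑ xs g) (∑ xs h))

  ∑-*ˡ : ∀ (xs : List A) r g → ∑ xs (λ x → r * g x) ≈ r * ∑ xs g
  ∑-*ˡ []       r g = sym (zeroʳ r)
  ∑-*ˡ (x ∷ xs) r g = trans (+-congˡ (∑-*ˡ xs r g)) (sym (distribˡ r _ _))

  ∑-*ʳ : ∀ (xs : List A) r g → ∑ xs (λ x → g x * r) ≈ ∑ xs g * r
  ∑-*ʳ xs r g = trans (∑-cong xs (λ _ → *-comm _ r)) (trans (∑-*ˡ xs r g) (*-comm r _))

  ∑-++ : ∀ (xs ys : List A) g → ∑ (xs ++ ys) g ≈ ∑ xs g + ∑ ys g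
  ∑-++ []       ys g = sym (+-identityˡ _)
  ∑-++ (x ∷ xs) ys g = trans (+-congˡ (∑-++ xs ys g)) (sym (+-assoc _ _ _))

  ∑-map : ∀ (xs : List A) (k : A → B) g → ∑ (map k xs) g ≈ ∑ xs (g ∘ k)
  ∑-map []       k g = refl
  ∑-map (x ∷ xs) k g = +-congˡ (∑-map xs k g)

  ∑-swap : ∀ (xs : List A) (ys : List B) (g : A → B → Carrier) →
           ∑ xs (λ x → ∑ ys (g x)) ≈ ∑ ys (λ y → ∑ xs (λ x → g x y))
  ∑-swap []       ys g = sym (∑-zero ys)
  ∑-swap (x ∷ xs) ys g =
    trans (+-congˡ (∑-swap xs ys g)) (sym (∑-+ ys (g x) (λ y → ∑ xs (λ x → g x y))))

  ∑-× : ∀ (xs : List A) (ys : List B) g h →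
        ∑ (cartesianProduct xs ys) (λ (x , y) → g x * h y) ≈ ∑ xs g * ∑ ys h
  ∑-× []       ys g h = sym (zeroˡ _)
  ∑-× (x ∷ xs) ys g h = begin
    ∑ (map (x ,_) ys ++ cartesianProduct xs ys) _
      ≈⟨ ∑-++ (map (x ,_) ys) (cartesianProduct xs ys) _ ⟩
    ∑ (map (x ,_) ys) _ + ∑ (cartesianProduct xs ys) _
      ≈⟨ +-cong (∑-map ys (x ,_) _) (∑-× xs ys g h) ⟩
    ∑ ys (λ y → g x * h y) + ∑ xs g * ∑ ys h
      ≈⟨ +-congʳ (∑-*ˡ ys (g x) h) ⟩
    g x * ∑ ys h + ∑ xs g * ∑ ys h
      ≈⟨ distribʳ (∑ ys h) (g x) (∑ xs g) ⟨
    (g x + ∑ xs g) * ∑ ys h ∎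
    where open ≈-Reasoning

  ∑-filter : ∀ {P : Pred A p} (P? : Decidable P) xs g →
             ∑ (filter P? xs) g ≈ ∑ xs (λ x → indicator (does (P? x)) * g x)
  ∑-filter P? []       g = refl
  ∑-filter P? (x ∷ xs) g with does (P? x)
  ... | true  = +-cong (sym (*-identityˡ (g x))) (∑-filter P? xs g)
  ... | false = trans (∑-filter P? xs g)
                  (trans (sym (+-identityˡ _)) (+-congʳ (sym (zeroˡ (g x)))))

  ∑-filter-≤ : ∀ {P : Pred A p} (P? : Decidable P) xs {g} → (∀ x → 0# ≤ g x) →
               ∑ (filter P? xs) g ≤ ∑ xs g
  ∑-filter-≤ P? xs {g} 0≤g = ≤-trans (≤-reflexive (∑-filter P? xs g))
    (∑-mono xs (λ {x} _ → indicator*≤ (does (P? x)) (0≤g x)))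

  -- Each entry of `xs` is cut out of `ys` at one occurrence. Since `xs` has no repetitions, its
  -- later entries survive the cut; what is left of `ys` in the end is nonnegative.
  ∑-⊆ : ∀ {xs ys : List A} {g} → (∀ x → 0# ≤ g x) → Unique xs →
        (∀ {x} → x ∈ xs → x ∈ ys) → ∑ xs g ≤ ∑ ys g
  ∑-⊆ {xs = []}     {ys} 0≤g _ _ = ∑-nonNeg ys 0≤g
  ∑-⊆ {xs = x ∷ xs} {ys} {g} 0≤g (x∉xs ∷ xs!) xs⊆ys with ∈-∃++ (xs⊆ys (here ≡-refl))
  ... | us , vs , ≡-refl = begin
    g x + ∑ xs g             ≤⟨ +-monoʳ-≤ (g x) (∑-⊆ 0≤g xs! xs⊆us++vs) ⟩
    g x + ∑ (us ++ vs) g     ≈⟨ +-congˡ (∑-++ us vs g) ⟩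
    g x + (∑ us g + ∑ vs g)  ≈⟨ solve 3 (λ a b c → a :+ (b :+ c) := b :+ (a :+ c)) refl
                                  (g x) (∑ us g) (∑ vs g) ⟩
    ∑ us g + ∑ (x ∷ vs) g    ≈⟨ ∑-++ us (x ∷ vs) g ⟨
    ∑ (us ++ x ∷ vs) g       ∎
    where
    open ≤-Reasoning
    xs⊆us++vs : ∀ {y} → y ∈ xs → y ∈ us ++ vs
    xs⊆us++vs y∈xs with ∈-++⁻ us (xs⊆ys (there y∈xs))
    ... | inj₁ y∈us         = ∈-++⁺ˡ y∈us
    ... | inj₂ (here ≡-refl) = contradiction ≡-refl (All.lookup x∉xs y∈xs)
    ... | inj₂ (there y∈vs) = ∈-++⁺ʳ us y∈vs

  term≤∑ : ∀ {xs : List A} {x g} → (∀ x → 0# ≤ g x) → x ∈ xs → g x ≤ ∑ xs g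
  term≤∑ {g = g} 0≤g x∈xs = ≤-trans (≤-reflexive (sym (+-identityʳ _)))
    (∑-⊆ 0≤g ([] ∷ []) λ { (here ≡-refl) → x∈xs })

  ∑-δ : ∀ (_≟A_ : DecidableEquality A) {xs} → Unique xs → ∀ {a} → a ∈ xs → (g : A → Carrier) →
        ∑ xs (λ x → g x * indicator (does (x ≟A a))) ≈ g a
  ∑-δ _≟A_ {x ∷ xs} (x∉xs ∷ xs!) {a} a∈ g with x ≟A a
  ... | yes ≡-refl = trans (+-cong (*-identityʳ (g a)) rest) (+-identityʳ (g a))
    where
    off : ∀ {y} → y ∈ xs → g y * indicator (does (y ≟A a)) ≈ 0#
    off {y} y∈xs with y ≟A a
    ... | yes ≡-refl = contradiction ≡-refl (All.lookup x∉xs y∈xs)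
    ... | no _ = zeroʳ (g y)
    rest : ∑ xs (λ y → g y * indicator (does (y ≟A a))) ≈ 0#
    rest = trans (∑-cong xs off) (∑-zero xs)
  ... | no x≢a with a∈
  ... | here ≡-refl = contradiction ≡-refl x≢a
  ... | there a∈xs = trans (+-cong (zeroʳ (g x)) (∑-δ _≟A_ xs! a∈xs g)) (+-identityˡ (g a))

  0<∑⇒∃0< : ∀ (xs : List A) {g} → 0# < ∑ xs g → ∃ λ x → x ∈ xs × 0# < g x
  0<∑⇒∃0< []       (_ , 0≉0) = contradiction refl 0≉0
  0<∑⇒∃0< (x ∷ xs) {g} 0<gx+∑ with 0# <? g x
  ... | yes 0<gx = x , here ≡-refl , 0<gx
  ... | no  0≮gx =
    let y , y∈xs , 0<gy = 0<∑⇒∃0< xs (<-≤-trans 0<gx+∑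
          (≤-trans (+-mono-≤ (≮⇒≥ 0≮gx) ≤-refl) (≤-reflexive (+-identityˡ _))))
    in y , there y∈xs , 0<gy

-- Fourier-Motzkin elimination

module LinearProgram {c ℓ₁ ℓ₂} (ℝ : CompleteOrderedField c ℓ₁ ℓ₂)
                     (log : CompleteOrderedField.Carrier ℝ → CompleteOrderedField.Carrier ℝ)
                     {a} {A : Set a} (_≟A_ : DecidableEquality A)
                     where

  open OrderedField ℝ log
  open Solver using (solve; _:=_; _:+_; _:*_)

  -- An affine function of the variables and of the objective value, read as the constraint that it
  -- be nonnegative. The objective value has a field of its own because it is the one unknown that
  -- is never eliminated.
  record Form : Set (c ⊔ a) where
    constructor form
    field
      coefficient : A → Carrier
      slope const : Carrier
  open Form

  value : List A → Form → (A → Carrier) → Carrier → Carrier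
  value xs p w v = ∑ xs (λ x → coefficient p x * w x) + (slope p * v + const p)

  record Feasible (xs : List A) (L : List Form) (w : A → Carrier) (v : Carrier) :
                  Set (c ⊔ ℓ₂ ⊔ a) where
    field
      objective≥0 : 0# ≤ v
      variables≥0 : ∀ x → 0# ≤ w x
      constraints : ∀ {p} → p ∈ L → 0# ≤ value xs p w v
  open Feasible

  -- The last component makes r the least solution.
  tightest : ∀ {P : Set (c ⊔ a)} (a b : P → Carrier) (L : List P) →
    ∃ λ r → 0# ≤ r ×
      (∀ {p} → p ∈ L → 0# < a p → 0# ≤ a p * r + b p) ×
      (r ≈ 0# ⊎ ∃ λ p → p ∈ L × 0# < a p × a p * r + b p ≈ 0#)
  tightest a b [] = 0# , ≤-refl , (λ ()) , inj₁ refl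
  tightest a b (p ∷ L) with tightest a b L | 0# <? a p
  ... | r , 0≤r , sat , tight | no 0≮a =
    r , 0≤r ,
    (λ { (here ≡-refl) 0<a → contradiction 0<a 0≮a ; (there p∈L) → sat p∈L }) ,
    Sum.map₂ (Product.map₂ (Product.map₁ there)) tight
  ... | r , 0≤r , sat , tight | yes 0<a with 0# ≤? a p * r + b p
  ... | yes 0≤ =
    r , 0≤r ,
    (λ { (here ≡-refl) _ → 0≤ ; (there p∈L) → sat p∈L }) ,
    Sum.map₂ (Product.map₂ (Product.map₁ there)) tight
  ... | no 0≰ =
    r′ , ≤-trans 0≤r r≤r′ ,
    (λ { (here ≡-refl) _ → ≤-reflexive (sym root)
       ; (there q∈L) 0<aq → ≤-trans (sat q∈L 0<aq)
           (+-mono-≤ (*-monoˡ-≤ (proj₁ 0<aq) r≤r′) ≤-refl) }) ,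
    inj₂ (p , here ≡-refl , 0<a , root)
    where
    -- `r′` is the root of the violated constraint. The latter increases and is negative at `r`, so
    -- its root lies to the right of `r`, where the earlier constraints of positive slope still
    -- hold.
    i  = proj₁ (reciprocal 0<a)
    r′ = i * - b p
    root : a p * r′ + b p ≈ 0#
    root = begin
      a p * (i * - b p) + b p ≈⟨ +-congʳ (*-assoc (a p) i _) ⟨
      a p * i * - b p + b p   ≈⟨ +-congʳ (*-congʳ (proj₂ (proj₂ (reciprocal 0<a)))) ⟩
      1# * - b p + b p        ≈⟨ +-congʳ (*-identityˡ _) ⟩
      - b p + b p             ≈⟨ -‿inverseˡ (b p) ⟩
      0#                      ∎
      where open ≈-Reasoning
    r≤r′ : r ≤ r′
    r≤r′ with total r r′
    ... | inj₁ r≤r′ = r≤r′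
    ... | inj₂ r′≤r = contradiction
      (≤-trans (≤-reflexive (sym root)) (+-mono-≤ (*-monoˡ-≤ (proj₁ 0<a) r′≤r) ≤-refl)) 0≰

  -- The multipliers make the coefficient of `x` cancel. If `p` increases in `x` and `q` does not,
  -- both multipliers are nonnegative, so the combination follows from `p` and `q`.
  combine : A → Form → Form → Form
  combine x p q = form (λ y → r * coefficient q y + s * coefficient p y)
                       (r * slope q + s * slope p) (r * const q + s * const p)
    where
    r = coefficient p x
    s = - coefficient q x

  value-combine : ∀ xs x p q w v →
    value xs (combine x p q) w v ≈
    coefficient p x * value xs q w v + (- coefficient q x) * value xs p w v
  value-combine xs x p q w v = begin
    ∑ xs (λ y → (r * coefficient q y + s * coefficient p y) * w y) + tail
      ≈⟨ +-congʳ (∑-cong xs (λ {y} _ → solve 5 (λ r s cq cp w →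
           (r :* cq :+ s :* cp) :* w := r :* (cq :* w) :+ s :* (cp :* w)) refl
           r s (coefficient q y) (coefficient p y) (w y))) ⟩
    ∑ xs (λ y → r * (coefficient q y * w y) + s * (coefficient p y * w y)) + tail
      ≈⟨ +-congʳ (trans (∑-+ xs _ _) (+-cong (∑-*ˡ xs r _) (∑-*ˡ xs s _))) ⟩
    r * ∑ xs (λ y → coefficient q y * w y) + s * ∑ xs (λ y → coefficient p y * w y) + tail
      ≈⟨ solve 9 (λ r s Q P aq ap bq bp v →
           (r :* Q :+ s :* P) :+ ((r :* aq :+ s :* ap) :* v :+ (r :* bq :+ s :* bp)) :=
           r :* (Q :+ (aq :* v :+ bq)) :+ s :* (P :+ (ap :* v :+ bp))) refl
           r s (∑ xs (λ y → coefficient q y * w y)) (∑ xs (λ y → coefficient p y * w y))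
           (slope q) (slope p) (const q) (const p) v ⟩
    r * value xs q w v + s * value xs p w v ∎
    where
    open ≈-Reasoning
    r = coefficient p x
    s = - coefficient q x
    tail = (r * slope q + s * slope p) * v + (r * const q + s * const p)

  value-∷ : ∀ x xs p w v → value (x ∷ xs) p w v ≈ coefficient p x * w x + value xs p w v
  value-∷ x xs p w v = +-assoc _ _ _

  module _ (x : A) (L : List Form) where

    private
      increasing? = λ (p : Form) → 0# <? coefficient p x
      increasing    = filter increasing? L
      nonincreasing = filter (¬? ∘ increasing?) L

    -- Every nonincreasing form is paired with each lower bound on x, namely
    -- those given by the increasing forms and 0 ≤ x.
    eliminate : List Form
    eliminate = nonincreasing ++ cartesianProductWith (combine x) increasing nonincreasing

    -- A nonincreasing form can only grow when its term in `w x ≥ 0` is dropped, and a combination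
    -- is a nonnegative one in which the terms in `x` cancel.
    eliminate-sound : ∀ {xs w v} → Feasible (x ∷ xs) L w v → Feasible xs eliminate w v
    eliminate-sound {xs} {w} {v} F = record
      { objective≥0 = objective≥0 F
      ; variables≥0 = variables≥0 F
      ; constraints = sat
      }
      where
      0≤∷ : ∀ {p} → p ∈ L → 0# ≤ coefficient p x * w x + value xs p w v
      0≤∷ {p} p∈L = ≤-trans (constraints F p∈L) (≤-reflexive (value-∷ x xs p w v))

      sat : ∀ {p} → p ∈ eliminate → 0# ≤ value xs p w v
      sat p∈ with ∈-++⁻ nonincreasing p∈
      sat {q} _ | inj₁ q∈ with ∈-filter⁻ (¬? ∘ increasing?) {xs = L} q∈
      ... | q∈L , 0≮q = begin
        0#                                       ≤⟨ 0≤∷ q∈L ⟩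
        coefficient q x * w x + value xs q w v
          ≤⟨ +-mono-≤ (*-monoʳ-≤ (variables≥0 F x) (≮⇒≥ 0≮q)) ≤-refl ⟩
        0# * w x + value xs q w v                ≈⟨ trans (+-congʳ (zeroˡ _)) (+-identityˡ _) ⟩
        value xs q w v                           ∎
        where open ≤-Reasoning
      sat _ | inj₂ pq∈ with ∈-cartesianProductWith⁻ (combine x) increasing nonincreasing pq∈
      ... | p , q , p∈ , q∈ , ≡-refl
        with ∈-filter⁻ increasing? {xs = L} p∈ | ∈-filter⁻ (¬? ∘ increasing?) {xs = L} q∈
      ... | p∈L , 0<p | q∈L , 0≮q = begin
        0#
          ≤⟨ +-nonNeg (*-nonNeg (proj₁ 0<p) (0≤∷ q∈L)) (*-nonNeg (≤0⇒0≤neg (≮⇒≥ 0≮q)) (0≤∷ p∈L)) ⟩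
        cp * (cq * w x + Q) + - cq * (cp * w x + P)
          ≈⟨ solve 6 (λ cp cq n w P Q → cp :* (cq :* w :+ Q) :+ n :* (cp :* w :+ P) :=
               (cq :+ n) :* (cp :* w) :+ (cp :* Q :+ n :* P)) refl cp cq (- cq) (w x) P Q ⟩
        (cq + - cq) * (cp * w x) + (cp * Q + - cq * P)
          ≈⟨ trans (+-congʳ (trans (*-congʳ (-‿inverseʳ cq)) (zeroˡ _))) (+-identityˡ _) ⟩
        cp * Q + - cq * P
          ≈⟨ value-combine xs x p q w v ⟨
        value xs (combine x p q) w v ∎
        where
        open ≤-Reasoning
        cp = coefficient p x
        cq = coefficient q x
        P = value xs p w v
        Q = value xs q w v

    -- The least `r` allowed by the increasing forms is the most favourable choice for the others.
    -- Either `r` is 0 and such a form survives elimination unchanged, or some increasing `p`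
    -- vanishes at `r`, and the combination of `p` with the form bounds the latter.
    eliminate-complete : ∀ {xs w v} → Feasible xs eliminate w v →
      ∃ λ r → 0# ≤ r × (∀ {p} → p ∈ L → 0# ≤ coefficient p x * r + value xs p w v)
    eliminate-complete {xs} {w} {v} F = r , 0≤r , sat
      where
      least = tightest (λ p → coefficient p x) (λ p → value xs p w v) L
      r = proj₁ least
      0≤r = proj₁ (proj₂ least)

      sat : ∀ {p} → p ∈ L → 0# ≤ coefficient p x * r + value xs p w v
      sat {q} q∈L with increasing? q
      ... | yes 0<q = proj₁ (proj₂ (proj₂ least)) q∈L 0<q
      ... | no  0≮q with proj₂ (proj₂ (proj₂ least))
      ... | inj₁ r≈0 = begin
        0#
          ≤⟨ constraints F (∈-++⁺ˡ (∈-filter⁺ (¬? ∘ increasing?) q∈L 0≮q)) ⟩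
        value xs q w v                         ≈⟨ trans (+-congʳ (zeroʳ _)) (+-identityˡ _) ⟨
        coefficient q x * 0# + value xs q w v  ≈⟨ +-congʳ (*-congˡ r≈0) ⟨
        coefficient q x * r + value xs q w v   ∎
        where open ≤-Reasoning
      ... | inj₂ (p , p∈L , 0<p , tight) = *-cancelˡ-nonNeg 0<p (begin
        0#
          ≤⟨ constraints F (∈-++⁺ʳ nonincreasing (∈-cartesianProductWith⁺ (combine x)
               (∈-filter⁺ increasing? p∈L 0<p) (∈-filter⁺ (¬? ∘ increasing?) q∈L 0≮q))) ⟩
        value xs (combine x p q) w v
          ≈⟨ value-combine xs x p q w v ⟩
        cp * Q + - cq * P
          -- Adding `cq` times the value of `p` at `r`, which is 0, turns the combination without
          -- `x` into a multiple of `q` at `r`.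
          ≈⟨ trans (+-congʳ (trans (*-congˡ tight) (zeroʳ cq))) (+-identityˡ _) ⟨
        cq * (cp * r + P) + (cp * Q + - cq * P)
          ≈⟨ solve 6 (λ cp cq n r P Q → cq :* (cp :* r :+ P) :+ (cp :* Q :+ n :* P) :=
               (cq :+ n) :* P :+ cp :* (cq :* r :+ Q)) refl cp cq (- cq) r P Q ⟩
        (cq + - cq) * P + cp * (cq * r + Q)
          ≈⟨ trans (+-congʳ (trans (*-congʳ (-‿inverseʳ cq)) (zeroˡ _))) (+-identityˡ _) ⟩
        cp * (cq * r + Q) ∎)
        where
        open ≤-Reasoning
        cp = coefficient p x
        cq = coefficient q x
        P = value xs p w v
        Q = value xs q w v

  _[_≔_] : (A → Carrier) → A → Carrier → (A → Carrier)
  (w [ x ≔ r ]) y = if does (y ≟A x) then r else w y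

  ≔-at : ∀ w x r → (w [ x ≔ r ]) x ≈ r
  ≔-at w x r with x ≟A x
  ... | yes _  = refl
  ... | no x≢x = contradiction ≡-refl x≢x

  ≔-off : ∀ w {x y} r → y ≢ x → (w [ x ≔ r ]) y ≈ w y
  ≔-off w {x} {y} r y≢x with y ≟A x
  ... | yes y≡x = contradiction y≡x y≢x
  ... | no _    = refl

  ≔-nonNeg : ∀ {w} x {r} → (∀ y → 0# ≤ w y) → 0# ≤ r → ∀ y → 0# ≤ (w [ x ≔ r ]) y
  ≔-nonNeg x 0≤w 0≤r y with y ≟A x
  ... | yes _ = 0≤r
  ... | no _  = 0≤w y

  -- Two outcomes are exhaustive: `Feasible` contains `0 ≤ v`, which excludes an unbounded
  -- objective.
  Minimum : List A → List Form → Set (c ⊔ ℓ₂ ⊔ a)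
  Minimum xs L =
    (∃₂ λ w v → Feasible xs L w v × (∀ {w′ v′} → Feasible xs L w′ v′ → v ≤ v′)) ⊎
    (∀ {w v} → ¬ Feasible xs L w v)

  -- With no variables left, `r` is the least value allowed by the forms increasing in `v`, hence a
  -- lower bound on every feasible value. The remaining forms are weakest at small `v`, so one that
  -- fails at `r` fails at every feasible value and there is none. Substituting an eliminated
  -- variable back leaves `v` alone, so minimality carries over through `eliminate-sound`.
  minimise : ∀ {xs} → Unique xs → (L : List Form) → Minimum xs L
  minimise {[]} [] L = answer (All.all? (λ p → 0# ≤? value [] p (λ _ → 0#) r) L)
    where
    least = tightest slope const L
    r = proj₁ least
    0≤r = proj₁ (proj₂ least)

    0≤slope*v+const : ∀ {w v p} → Feasible [] L w v → p ∈ L → 0# ≤ slope p * v + const p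
    0≤slope*v+const F p∈L = ≤-trans (constraints F p∈L) (≤-reflexive (+-identityˡ _))

    r≤ : ∀ {w v} → Feasible [] L w v → r ≤ v
    r≤ {w} {v} F with proj₂ (proj₂ (proj₂ least))
    ... | inj₁ r≈0 = ≤-trans (≤-reflexive r≈0) (objective≥0 F)
    ... | inj₂ (p , p∈L , 0<p , tight) = *-cancelˡ-≤ 0<p (+-cancelʳ-≤ (const p)
      (≤-trans (≤-reflexive tight) (0≤slope*v+const F p∈L)))

    sat : ∀ {w v} → Feasible [] L w v → ∀ {p} → p ∈ L → 0# ≤ slope p * r + const p
    sat {w} {v} F {p} p∈L with 0# <? slope p
    ... | yes 0<p = proj₁ (proj₂ (proj₂ least)) p∈L 0<p
    ... | no  0≮p = ≤-trans (0≤slope*v+const F p∈L)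
                      (+-mono-≤ (*-antimonoˡ-≤ (≮⇒≥ 0≮p) (r≤ F)) ≤-refl)

    answer : Dec (All (λ p → 0# ≤ value [] p (λ _ → 0#) r) L) → Minimum [] L
    answer (yes all) = inj₁ ((λ _ → 0#) , r , record
      { objective≥0 = 0≤r
      ; variables≥0 = λ _ → ≤-refl
      ; constraints = All.lookup all
      } , r≤)
    answer (no ¬all) = inj₂ λ F →
      ¬all (All.tabulate λ p∈L → ≤-trans (sat F p∈L) (≤-reflexive (sym (+-identityˡ _))))
  minimise {x ∷ xs} (x∉xs ∷ xs!) L with minimise xs! (eliminate x L)
  ... | inj₂ none = inj₂ (none ∘ eliminate-sound x L)
  ... | inj₁ (w , v , F , least) with eliminate-complete x L F
  ... | r , 0≤r , sat = inj₁ (w [ x ≔ r ] , v , record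
          { objective≥0 = objective≥0 F
          ; variables≥0 = ≔-nonNeg x (variables≥0 F) 0≤r
          ; constraints = λ {p} p∈L → ≤-trans (sat p∈L) (≤-reflexive (sym (begin
              value (x ∷ xs) p (w [ x ≔ r ]) v
                ≈⟨ value-∷ x xs p (w [ x ≔ r ]) v ⟩
              coefficient p x * (w [ x ≔ r ]) x + value xs p (w [ x ≔ r ]) v
                ≈⟨ +-cong (*-congˡ (≔-at w x r)) (+-congʳ (∑-cong xs (λ y∈xs →
                     *-congˡ (≔-off w r λ { ≡-refl → All.lookup x∉xs y∈xs ≡-refl })))) ⟩
              coefficient p x * r + value xs p w v ∎)))
          } , least ∘ eliminate-sound x L)
    where open ≈-Reasoning

-- Nonnegative series as suprema of finite partial sums

module Series {c ℓ₁ ℓ₂} (ℝ : CompleteOrderedField c ℓ₁ ℓ₂)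
              (log : CompleteOrderedField.Carrier ℝ → CompleteOrderedField.Carrier ℝ)
              where

  open OrderedField ℝ log
  open Relation.Binary.Construct.Add.Supremum.Equality _≈_ using ([_]; ≈⁺-refl)
  open Relation.Binary.Construct.Add.Supremum.NonStrict _≤_ using ([_]; _≤⊤⁺; [≤]-injective)

  ≤⁺-respˡ : ∀ {u v w} → u ≈⁺ v → v ≤⁺ w → u ≤⁺ w
  ≤⁺-respˡ {w = ⊤⁺} _ _ = _ ≤⊤⁺
  ≤⁺-respˡ [ u≈v ] [ v≤w ] = [ ≤-trans (≤-reflexive u≈v) v≤w ]

  private variable
    A : Set
    g h : A → Carrier

  PartialSums≤ : (A → Carrier) → Carrier → Set ℓ₂
  PartialSums≤ {A} g b = ∀ (as : List A) → Unique as → ∑ as g ≤ b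

  -- The real-valued counterpart of `IsSum`: bounds range over the field itself, so that ordinary
  -- arithmetic applies to them.
  HasSum : (A → Carrier) → Carrier → Set (c ⊔ ℓ₂)
  HasSum g s = PartialSums≤ g s × (∀ {b} → PartialSums≤ g b → s ≤ b)

  IsSum⇒partialSums≤ : ∀ {s b} → IsSum g s → s ≤⁺ [ b ] → PartialSums≤ g b
  IsSum⇒partialSums≤ (upper , _) s≤b as as! with upper (as , as! , ≈⁺-refl refl) | s≤b
  ... | [ ∑≤s ] | [ s≤b ] = ≤-trans ∑≤s s≤b

  IsSum⇒≤ : ∀ {s b} → IsSum g s → PartialSums≤ g b → s ≤⁺ [ b ]
  IsSum⇒≤ (_ , least) sums≤b = least λ { (as , as! , v≈) → ≤⁺-respˡ v≈ [ sums≤b as as! ] }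

  IsSum⇒HasSum : ∀ {s} → IsSum g [ s ] → HasSum g s
  IsSum⇒HasSum isSum =
    IsSum⇒partialSums≤ isSum [ ≤-refl ] ,
    λ sums≤b → [≤]-injective (IsSum⇒≤ isSum sums≤b)

  HasSum⇒IsSum : ∀ {s} → HasSum g s → IsSum g [ s ]
  HasSum⇒IsSum {g = g} {s} (upper , least) =
    (λ { (as , as! , v≈) → ≤⁺-respˡ v≈ [ upper as as! ] }) , least⁺
    where
    least⁺ : ∀ {b} → IsUpperBound _≤⁺_ (λ v → ∃ λ as → Unique as × v ≈⁺ [ ∑ as g ]) b → [ s ] ≤⁺ b
    least⁺ {⊤⁺}    _  = _ ≤⊤⁺
    least⁺ {[ b ]} ub = [ least sums≤b ]
      where
      sums≤b : PartialSums≤ g b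
      sums≤b as as! with ub (as , as! , ≈⁺-refl refl)
      ... | [ ∑≤b ] = ∑≤b

  HasSum-unique : ∀ {s t} → HasSum g s → HasSum g t → s ≈ t
  HasSum-unique (upper , least) (upper′ , least′) = antisym (least upper′) (least′ upper)

  HasSum-resp : ∀ {s} → (∀ a → g a ≈ h a) → HasSum g s → HasSum h s
  HasSum-resp g≈h (upper , least) =
    (λ as as! → ≤-trans (≤-reflexive (∑-cong as λ {a} _ → sym (g≈h a))) (upper as as!)) ,
    λ ub → least λ as as! → ≤-trans (≤-reflexive (∑-cong as λ {a} _ → g≈h a)) (ub as as!)

  HasSum-respʳ : ∀ {s t} → s ≈ t → HasSum g s → HasSum g t
  HasSum-respʳ s≈t (upper , least) =
    (λ as as! → ≤-trans (upper as as!) (≤-reflexive s≈t)) ,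
    λ ub → ≤-trans (≤-reflexive (sym s≈t)) (least ub)

  HasSum-mono : ∀ {s t} → (∀ a → g a ≤ h a) → HasSum g s → HasSum h t → s ≤ t
  HasSum-mono g≤h (_ , least) (upper , _) =
    least λ as as! → ≤-trans (∑-mono as λ {a} _ → g≤h a) (upper as as!)

  sum-nonNeg : ∀ {s} → HasSum g s → 0# ≤ s
  sum-nonNeg (upper , _) = upper [] []

  -- This is where completeness of the field enters. `Lift` moves the set of partial sums to the
  -- universe level that `supremum` prescribes.
  bounded⇒HasSum : ∀ {A : Set} {g : A → Carrier} {b} → PartialSums≤ g b → ∃ (HasSum g)
  bounded⇒HasSum {A} {g} {b} sums≤b =
    s , (λ as as! → proj₁ sup (lift (as , as! , refl))) ,
    λ ub → proj₂ sup λ { (lift (as , as! , x≈)) → ≤-trans (≤-reflexive x≈) (ub as as!) }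
    where
    Partial : Carrier → Set (c ⊔ ℓ₁ ⊔ ℓ₂)
    Partial x = Lift (c ⊔ ℓ₂) (∃ λ (as : List A) → Unique as × x ≈ ∑ as g)
    sup′ = supremum Partial (0# , lift ([] , [] , refl))
      (b , λ { (lift (as , as! , x≈)) → ≤-trans (≤-reflexive x≈) (sums≤b as as!) })
    s = proj₁ sup′
    sup : IsSupremum _≤_ Partial s
    sup = proj₂ sup′

  finite⇒HasSum : (∀ a → 0# ≤ g a) → ∀ {as} → Unique as → (∀ a → a ∈ as) → HasSum g (∑ as g)
  finite⇒HasSum 0≤g {as} as! complete =
    (λ bs bs! → ∑-⊆ 0≤g bs! λ {a} _ → complete a) , λ ub → ub as as!

  module _ {A : Set} (_≟A_ : DecidableEquality A) where

    open DecMembership _≟A_ using () renaming (_∈?_ to _∈A?_)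

    -- The two suprema are approached along different lists, while a bound on the sums of `g + h`
    -- speaks of one list at a time. `joint` passes to the union of both lists, which only increases
    -- the sums; removing duplicates from it takes decidable equality. The suprema over `bs` and
    -- `as` are then taken one after the other.
    HasSum-+ : ∀ {g h s t} → (∀ a → 0# ≤ g a) → (∀ a → 0# ≤ h a) →
               HasSum g s → HasSum h t → HasSum (λ a → g a + h a) (s + t)
    HasSum-+ {g} {h} {s} {t} 0≤g 0≤h (upper , least) (upper′ , least′) =
      (λ as as! → ≤-trans (≤-reflexive (∑-+ as g h)) (+-mono-≤ (upper as as!) (upper′ as as!))) ,
      λ {b} ub → ≤-trans (≤-reflexive (+-comm s t)) (≤-⇒+≤ (least λ as as! →
        +≤⇒≤- (≤-trans (≤-reflexive (+-comm t _)) (≤-⇒+≤ (least′ λ bs bs! →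
        +≤⇒≤- (joint ub as as! bs bs!))))))
      where
      joint : ∀ {b} → PartialSums≤ (λ a → g a + h a) b → ∀ as → Unique as → ∀ bs → Unique bs →
              ∑ as g + ∑ bs h ≤ b
      joint {b} ub as as! bs bs! = begin
        ∑ as g + ∑ bs h             ≤⟨ +-mono-≤ (∑-⊆ 0≤g as! ∈-++⁺ˡ) (∑-⊆ 0≤h bs! bs⊆) ⟩
        ∑ as∪bs g + ∑ as∪bs h       ≈⟨ ∑-+ as∪bs g h ⟨
        ∑ as∪bs (λ a → g a + h a)   ≤⟨ ub as∪bs as∪bs! ⟩
        b                           ∎
        where
        open ≤-Reasoning
        new? = λ a → ¬? (a ∈A? as)
        as∪bs = as ++ filter new? bs
        as∪bs! : Unique as∪bs
        as∪bs! = Unique.++⁺ as! (Unique.filter⁺ new? bs!)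
                   λ { (a∈as , a∈new) → proj₂ (∈-filter⁻ new? {xs = bs} a∈new) a∈as }
        bs⊆ : ∀ {a} → a ∈ bs → a ∈ as∪bs
        bs⊆ {a} a∈bs with a ∈A? as
        ... | yes a∈as = ∈-++⁺ˡ a∈as
        ... | no  a∉as = ∈-++⁺ʳ as (∈-filter⁺ new? a∈bs a∉as)

    HasSum-∑ : ∀ {b} {B : Set b} (ts : List B) {g : A → B → Carrier} {s : B → Carrier} →
               (∀ a t → 0# ≤ g a t) → (∀ t → HasSum (λ a → g a t) (s t)) →
               HasSum (λ a → ∑ ts (g a)) (∑ ts s)
    HasSum-∑ []       0≤g sums =
      (λ as _ → ≤-reflexive (∑-zero as)) , λ ub → ub [] []
    HasSum-∑ (t ∷ ts) 0≤g sums =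
      HasSum-+ (λ a → 0≤g a t) (λ a → ∑-nonNeg ts (0≤g a)) (sums t) (HasSum-∑ ts 0≤g sums)

-- Independent rounding of the two sides of a rectangle

module Rounding {c ℓ₁ ℓ₂} (ℝ : CompleteOrderedField c ℓ₁ ℓ₂)
                (log : CompleteOrderedField.Carrier ℝ → CompleteOrderedField.Carrier ℝ)
                where

  open OrderedField ℝ log
  open Solver using (solve; _:=_; _:+_; _:*_)

  -- The probability of S when each x is put into S independently with
  -- probability a x.
  rounding : ∀ {n} → (Fin n → Carrier) → Subset n → Carrier
  rounding a []      = 1#
  rounding a (s ∷ S) = (if s then a zero else 1# - a zero) * rounding (a ∘ suc) S

  rounding-nonNeg : ∀ {n} {a : Fin n → Carrier} → (∀ x → 0# ≤ a x × a x ≤ 1#) →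
                    ∀ S → 0# ≤ rounding a S
  rounding-nonNeg 0≤a≤1 []            = 0≤1
  rounding-nonNeg 0≤a≤1 (outside ∷ S) =
    *-nonNeg (≤⇒0≤- (proj₂ (0≤a≤1 zero))) (rounding-nonNeg (0≤a≤1 ∘ suc) S)
  rounding-nonNeg 0≤a≤1 (inside ∷ S)  =
    *-nonNeg (proj₁ (0≤a≤1 zero)) (rounding-nonNeg (0≤a≤1 ∘ suc) S)

  ∑-subsets-suc : ∀ n (g : Subset (suc n) → Carrier) →
    ∑ (subsets (suc n)) g ≈
    ∑ (subsets n) (λ S → g (outside ∷ S)) + ∑ (subsets n) (λ S → g (inside ∷ S))
  ∑-subsets-suc n g = trans (∑-++ (map (outside ∷_) (subsets n)) _ g)
    (+-cong (∑-map (subsets n) (outside ∷_) g) (∑-map (subsets n) (inside ∷_) g))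

  1-x+x≈1 : ∀ x → 1# - x + x ≈ 1#
  1-x+x≈1 x = trans (+-comm _ x) (x+[y-x]≈y x 1#)

  ∑-rounding : ∀ {n} (a : Fin n → Carrier) → ∑ (subsets n) (rounding a) ≈ 1#
  ∑-rounding {0}     a = +-identityʳ 1#
  ∑-rounding {suc n} a = begin
    ∑ (subsets (suc n)) (rounding a)
      ≈⟨ ∑-subsets-suc n (rounding a) ⟩
    ∑ (subsets n) (λ S → (1# - a zero) * ρ S) + ∑ (subsets n) (λ S → a zero * ρ S)
      ≈⟨ +-cong (∑-*ˡ (subsets n) _ ρ) (∑-*ˡ (subsets n) _ ρ) ⟩
    (1# - a zero) * ∑ (subsets n) ρ + a zero * ∑ (subsets n) ρ
      ≈⟨ distribʳ _ _ _ ⟨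
    (1# - a zero + a zero) * ∑ (subsets n) ρ
      ≈⟨ *-cong (1-x+x≈1 (a zero)) (∑-rounding (a ∘ suc)) ⟩
    1# * 1#
      ≈⟨ *-identityˡ 1# ⟩
    1# ∎
    where
    open ≈-Reasoning
    ρ = rounding (a ∘ suc)

  -- The marginal of a product distribution: the coordinates other than `x` sum out to 1.
  ∑-rounding-∋ : ∀ {n} (a : Fin n → Carrier) x →
    ∑ (subsets n) (λ S → indicator (does (x ∈? S)) * rounding a S) ≈ a x
  ∑-rounding-∋ {suc n} a zero = begin
    ∑ (subsets (suc n)) (λ S → indicator (does (zero ∈? S)) * rounding a S)
      ≈⟨ ∑-subsets-suc n _ ⟩
    ∑ (subsets n) (λ S → 0# * ((1# - a zero) * ρ S)) + ∑ (subsets n) (λ S → 1# * (a zero * ρ S))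
      ≈⟨ +-cong (trans (∑-cong (subsets n) λ _ → zeroˡ _) (∑-zero (subsets n)))
                (trans (∑-cong (subsets n) λ _ → *-identityˡ _) (∑-*ˡ (subsets n) _ ρ)) ⟩
    0# + a zero * ∑ (subsets n) ρ
      ≈⟨ trans (+-identityˡ _) (trans (*-congˡ (∑-rounding (a ∘ suc))) (*-identityʳ _)) ⟩
    a zero ∎
    where
    open ≈-Reasoning
    ρ = rounding (a ∘ suc)
  ∑-rounding-∋ {suc n} a (suc x) = begin
    ∑ (subsets (suc n)) (λ S → indicator (does (suc x ∈? S)) * rounding a S)
      ≈⟨ ∑-subsets-suc n _ ⟩
    ∑ (subsets n) (λ S → i S * ((1# - a zero) * ρ S)) + ∑ (subsets n) (λ S → i S * (a zero * ρ S))
      ≈⟨ +-cong (pull (1# - a zero)) (pull (a zero)) ⟩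
    (1# - a zero) * ∑ (subsets n) (λ S → i S * ρ S) + a zero * ∑ (subsets n) (λ S → i S * ρ S)
      ≈⟨ distribʳ _ _ _ ⟨
    (1# - a zero + a zero) * ∑ (subsets n) (λ S → i S * ρ S)
      ≈⟨ *-cong (1-x+x≈1 (a zero)) (∑-rounding-∋ (a ∘ suc) x) ⟩
    1# * a (suc x)
      ≈⟨ *-identityˡ _ ⟩
    a (suc x) ∎
    where
    open ≈-Reasoning
    ρ = rounding (a ∘ suc)
    i = λ S → indicator (does (x ∈? S))
    pull : ∀ r → ∑ (subsets n) (λ S → i S * (r * ρ S)) ≈ r * ∑ (subsets n) (λ S → i S * ρ S)
    pull r = trans (∑-cong (subsets n) λ {S} _ →
      solve 3 (λ i r ρ → i :* (r :* ρ) := r :* (i :* ρ)) refl (i S) r (ρ S))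
      (∑-*ˡ (subsets n) r _)

  module _ {m n k : ℕ} (M : Carrier) (a : Fin m → Carrier) (b : Fin n → Carrier)
           (out : Fin k) where

    tileWeight : Tile m n k → Carrier
    tileWeight ((X , Y) , z) =
      M * ((rounding a X * rounding b Y) * indicator (does (z Fin.≟ out)))

    tileWeight-nonNeg : 0# ≤ M → (∀ x → 0# ≤ a x × a x ≤ 1#) → (∀ y → 0# ≤ b y × b y ≤ 1#) →
                        ∀ t → 0# ≤ tileWeight t
    tileWeight-nonNeg 0≤M 0≤a≤1 0≤b≤1 ((X , Y) , z) =
      *-nonNeg 0≤M (*-nonNeg (*-nonNeg (rounding-nonNeg 0≤a≤1 X) (rounding-nonNeg 0≤b≤1 Y))
        (indicator-nonNeg (does (z Fin.≟ out))))

    -- Row side, column side and label are chosen independently, so each of the three sums over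
    -- tiles below splits into three separate factors.
    ∑-product : ∀ F G H {g : Tile m n k → Carrier} →
      (∀ X Y z → g ((X , Y) , z) ≈ M * ((F X * G Y) * H z)) →
      ∑ (allTiles m n k) g ≈ M * ((∑ (subsets m) F * ∑ (subsets n) G) * ∑ (allFin k) H)
    ∑-product F G H g≈ = begin
      ∑ (allTiles m n k) _
        ≈⟨ ∑-cong (allTiles m n k) (λ { {(X , Y) , z} _ → g≈ X Y z }) ⟩
      ∑ (allTiles m n k) (λ ((X , Y) , z) → M * ((F X * G Y) * H z))
        ≈⟨ ∑-*ˡ (allTiles m n k) M _ ⟩
      M * ∑ (allTiles m n k) (λ ((X , Y) , z) → (F X * G Y) * H z)
        ≈⟨ *-congˡ (∑-× (cartesianProduct (subsets m) (subsets n)) (allFin k) _ H) ⟩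
      M * (∑ (cartesianProduct (subsets m) (subsets n)) (λ (X , Y) → F X * G Y) * ∑ (allFin k) H)
        ≈⟨ *-congˡ (*-congʳ (∑-× (subsets m) (subsets n) F G)) ⟩
      M * ((∑ (subsets m) F * ∑ (subsets n) G) * ∑ (allFin k) H) ∎
      where open ≈-Reasoning

    ∑-out : ∀ (g : Fin k → Carrier) →
      ∑ (allFin k) (λ z → g z * indicator (does (z Fin.≟ out))) ≈ g out
    ∑-out = ∑-δ Fin._≟_ (Unique.allFin⁺ k) (∈-allFin out)

    ∑-1-out : ∑ (allFin k) (λ z → indicator (does (z Fin.≟ out))) ≈ 1#
    ∑-1-out = trans (∑-cong (allFin k) λ _ → sym (*-identityˡ _)) (∑-out λ _ → 1#)

    ∑-tileWeight : ∑ (allTiles m n k) tileWeight ≈ M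
    ∑-tileWeight = begin
      ∑ (allTiles m n k) tileWeight
        ≈⟨ ∑-product (rounding a) (rounding b) _ (λ _ _ _ → refl) ⟩
      M * ((∑ (subsets m) (rounding a) * ∑ (subsets n) (rounding b)) * ∑ (allFin k) _)
        ≈⟨ *-congˡ (*-cong (*-cong (∑-rounding a) (∑-rounding b)) ∑-1-out) ⟩
      M * ((1# * 1#) * 1#)
        ≈⟨ trans (*-congˡ (trans (*-identityʳ _) (*-identityʳ _))) (*-identityʳ M) ⟩
      M ∎
      where open ≈-Reasoning

    ∑-tileWeight-∋ : ∀ x y →
      ∑ (allTiles m n k) (λ t → indicator (does ((x , y) ∈ₜ? t)) * tileWeight t) ≈ M * (a x * b y)
    ∑-tileWeight-∋ x y = begin
      ∑ (allTiles m n k) _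
        ≈⟨ ∑-product (λ X → i X * rounding a X) (λ Y → j Y * rounding b Y) δ (λ X Y z →
             trans (*-congʳ (indicator-∧ (does (x ∈? X)) (does (y ∈? Y))))
               (solve 6 (λ i j M r s d → (i :* j) :* (M :* ((r :* s) :* d)) :=
                  M :* (((i :* r) :* (j :* s)) :* d)) refl
                  (i X) (j Y) M (rounding a X) (rounding b Y) (δ z))) ⟩
      M * ((∑ (subsets m) _ * ∑ (subsets n) _) * ∑ (allFin k) δ)
        ≈⟨ *-congˡ (*-cong (*-cong (∑-rounding-∋ a x) (∑-rounding-∋ b y)) ∑-1-out) ⟩
      M * ((a x * b y) * 1#)
        ≈⟨ *-congˡ (*-identityʳ _) ⟩
      M * (a x * b y) ∎
      where
      open ≈-Reasoning
      i = λ X → indicator (does (x ∈? X))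
      j = λ Y → indicator (does (y ∈? Y))
      δ = λ z → indicator (does (z Fin.≟ out))

    ∑-tileWeight-∋-labelled : ∀ x y (Z : Subset k) →
      ∑ (allTiles m n k)
        (λ t → indicator (does ((x , y) ∈ₜ? t) ∧ does (label t ∈? Z)) * tileWeight t) ≈
      M * (a x * b y * indicator (does (out ∈? Z)))
    ∑-tileWeight-∋-labelled x y Z = begin
      ∑ (allTiles m n k) _
        ≈⟨ ∑-product (λ X → i X * rounding a X) (λ Y → j Y * rounding b Y)
             (λ z → l z * δ z) (λ X Y z →
             trans (*-congʳ (trans (indicator-∧ (does (x ∈? X) ∧ does (y ∈? Y)) (does (z ∈? Z)))
               (*-congʳ (indicator-∧ (does (x ∈? X)) (does (y ∈? Y))))))
               (solve 7 (λ i j l M r s d → ((i :* j) :* l) :* (M :* ((r :* s) :* d)) :=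
                  M :* (((i :* r) :* (j :* s)) :* (l :* d))) refl
                  (i X) (j Y) (l z) M (rounding a X) (rounding b Y) (δ z))) ⟩
      M * ((∑ (subsets m) _ * ∑ (subsets n) _) * ∑ (allFin k) (λ z → l z * δ z))
        ≈⟨ *-congˡ (*-cong (*-cong (∑-rounding-∋ a x) (∑-rounding-∋ b y)) (∑-out l)) ⟩
      M * (a x * b y * l out) ∎
      where
      open ≈-Reasoning
      i = λ X → indicator (does (x ∈? X))
      j = λ Y → indicator (does (y ∈? Y))
      l = λ z → indicator (does (z ∈? Z))
      δ = λ z → indicator (does (z Fin.≟ out))

-- Fractional partitions as a linear program

module Partition {c ℓ₁ ℓ₂} (ℝ : CompleteOrderedField c ℓ₁ ℓ₂)
                 (log : CompleteOrderedField.Carrier ℝ → CompleteOrderedField.Carrier ℝ)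
                 {m n k : ℕ} (f : Fin m → Fin n → Subset k)
                 (ℰ : Fin m → Fin n → CompleteOrderedField.Carrier ℝ)
                 where

  open OrderedField ℝ log
  open LinearProgram ℝ log (_≟ₜ_ {m} {n} {k})
  open IsFractionalPartition
  open Feasible

  tiles : List (Tile m n k)
  tiles = allTiles m n k

  covers correct : Fin m × Fin n → Tile m n k → Carrier
  covers  xy      t = indicator (does (xy ∈ₜ? t))
  correct (x , y) t = indicator (does (((x , y) ∈ₜ? t) ×-dec (label t ∈? f x y)))

  totalWeight : (Tile m n k → Carrier) → (Tile m n k → Carrier) → Carrier
  totalWeight r w = ∑ tiles (λ t → r t * w t)

  atLeast : (Tile m n k → Carrier) → Carrier → Form
  atLeast r b = form r 0# (- b)

  -- The upper bound is `s * v + b`, so that a constant bound (`s` zero) and a bound by the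
  -- objective value (`s` one) have the same shape.
  atMost : (Tile m n k → Carrier) → Carrier → Carrier → Form
  atMost r s b = form (λ t → - r t) s b

  value-atLeast : ∀ r b w v → value tiles (atLeast r b) w v ≈ totalWeight r w - b
  value-atLeast r b w v = +-congˡ (trans (+-congʳ (zeroˡ v)) (+-identityˡ (- b)))

  value-atMost : ∀ r s b w v → value tiles (atMost r s b) w v ≈ s * v + b - totalWeight r w
  value-atMost r s b w v = trans (+-comm _ _) (+-congˡ (begin
    ∑ tiles (λ t → - r t * w t)         ≈⟨ ∑-cong tiles (λ {t} _ → neg-* (r t) (w t)) ⟩
    ∑ tiles (λ t → - 1# * (r t * w t))  ≈⟨ ∑-*ˡ tiles (- 1#) _ ⟩
    - 1# * totalWeight r w              ≈⟨ -1*x≈-x _ ⟩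
    - totalWeight r w                   ∎))
    where
    open ≈-Reasoning
    neg-* : ∀ x y → - x * y ≈ - 1# * (x * y)
    neg-* x y = trans (sym (-‿distribˡ-* x y)) (sym (-1*x≈-x (x * y)))

  cap : Tile m n k → Form
  cap t = atMost (λ s → indicator (does (s ≟ₜ t))) 0# 1#

  coverBelow coverAbove errorBound : Fin m × Fin n → Form
  coverBelow xy      = atLeast (covers xy) 1#
  coverAbove xy      = atMost (covers xy) 0# 1#
  errorBound (x , y) = atLeast (correct (x , y)) (1# - ℰ x y)

  -- Epigraph form: `v` becomes an unknown bounded below by the total weight, and minimising `v`
  -- minimises that weight.
  objective : Form
  objective = atMost (λ _ → 1#) 1# 0#

  caps coverBelows coverAboves errorBounds program : List Form
  caps    = map cap tiles
  coverBelows = map coverBelow (inputs m n)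
  coverAboves = map coverAbove (inputs m n)
  errorBounds = map errorBound (inputs m n)
  program = objective ∷ caps ++ coverBelows ++ coverAboves ++ errorBounds

  ∑-at : ∀ t w → totalWeight (λ s → indicator (does (s ≟ₜ t))) w ≈ w t
  ∑-at t w = trans (∑-cong tiles λ _ → *-comm _ _)
               (∑-δ _≟ₜ_ (allTiles-unique m n k) (allTiles-complete t) w)

  ∑-1* : ∀ w → totalWeight (λ _ → 1#) w ≈ ∑ tiles w
  ∑-1* w = ∑-cong tiles λ _ → *-identityˡ _

  0*v+b : ∀ {v b} → 0# * v + b ≈ b
  0*v+b = trans (+-congʳ (zeroˡ _)) (+-identityˡ _)

  1*v+0 : ∀ {v} → 1# * v + 0# ≈ v
  1*v+0 = trans (+-identityʳ _) (*-identityˡ _)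

  partition⇒feasible : ∀ {w} → IsFractionalPartition f ℰ w → Feasible tiles program w (∑ tiles w)
  partition⇒feasible {w} P = record
    { objective≥0 = ∑-nonNeg tiles (nonNeg P)
    ; variables≥0 = nonNeg P
    ; constraints = sat
    }
    where
    v = ∑ tiles w
    atLeast-sat : ∀ r {b} → b ≤ totalWeight r w → 0# ≤ value tiles (atLeast r b) w v
    atLeast-sat r b≤ = ≤-trans (≤⇒0≤- b≤) (≤-reflexive (sym (value-atLeast r _ w v)))
    atMost-sat : ∀ r {s b} → totalWeight r w ≤ s * v + b → 0# ≤ value tiles (atMost r s b) w v
    atMost-sat r ≤sv+b = ≤-trans (≤⇒0≤- ≤sv+b) (≤-reflexive (sym (value-atMost r _ _ w v)))

    sat : ∀ {p} → p ∈ program → 0# ≤ value tiles p w v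
    sat (here ≡-refl) = atMost-sat (λ _ → 1#) (≤-reflexive (trans (∑-1* w) (sym 1*v+0)))
    sat (there p∈) with ∈-++⁻ caps p∈
    ... | inj₁ p∈caps with ∈-map⁻ cap p∈caps
    ... | t , _ , ≡-refl = atMost-sat (λ s → indicator (does (s ≟ₜ t)))
          (≤-trans (≤-reflexive (∑-at t w)) (≤-trans (≤1 P t) (≤-reflexive (sym 0*v+b))))
    sat (there p∈) | inj₂ p∈′ with ∈-++⁻ coverBelows p∈′
    ... | inj₁ p∈cb with ∈-map⁻ coverBelow p∈cb
    ... | (x , y) , _ , ≡-refl = atLeast-sat (covers (x , y))
          (≤-reflexive (trans (sym (cover P x y)) (∑-filter ((x , y) ∈ₜ?_) tiles w)))
    sat (there p∈) | inj₂ p∈′ | inj₂ p∈″ with ∈-++⁻ coverAboves p∈″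
    ... | inj₁ p∈ca with ∈-map⁻ coverAbove p∈ca
    ... | (x , y) , _ , ≡-refl = atMost-sat (covers (x , y)) (≤-reflexive
          (trans (sym (∑-filter ((x , y) ∈ₜ?_) tiles w)) (trans (cover P x y) (sym 0*v+b))))
    sat (there p∈) | inj₂ p∈′ | inj₂ p∈″ | inj₂ p∈eb with ∈-map⁻ errorBound p∈eb
    ... | (x , y) , _ , ≡-refl = atLeast-sat (correct (x , y))
          (≤-trans (error P x y) (≤-reflexive (∑-filter _ tiles w)))

  -- The bound on the total weight is only an inequality since `v` may exceed it. This suffices for
  -- optimality, as each competing partition is feasible with `v` equal to its own weight.
  feasible⇒partition : ∀ {w v} → Feasible tiles program w v →
                       IsFractionalPartition f ℰ w × ∑ tiles w ≤ v
  feasible⇒partition {w} {v} F = record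
    { nonNeg = variables≥0 F
    ; ≤1     = λ t → ≤-trans (≤-reflexive (sym (∑-at t w)))
                 (≤-trans (atMost-sat (λ s → indicator (does (s ≟ₜ t)))
                    (there (∈-++⁺ˡ (∈-map⁺ cap (allTiles-complete t))))) (≤-reflexive 0*v+b))
    ; cover  = λ x y → trans (∑-filter ((x , y) ∈ₜ?_) tiles w) (antisym
                 (≤-trans (atMost-sat (covers (x , y))
                   (there (∈-++⁺ʳ caps (∈-++⁺ʳ coverBelows (∈-++⁺ˡ
                     (∈-map⁺ coverAbove (inputs-complete (x , y))))))))
                   (≤-reflexive 0*v+b))
                 (atLeast-sat (covers (x , y))
                   (there (∈-++⁺ʳ caps (∈-++⁺ˡ
                     (∈-map⁺ coverBelow (inputs-complete (x , y))))))))
    ; error  = λ x y → ≤-trans (atLeast-sat (correct (x , y))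
                   (there (∈-++⁺ʳ caps (∈-++⁺ʳ coverBelows (∈-++⁺ʳ coverAboves
                     (∈-map⁺ errorBound (inputs-complete (x , y))))))))
                 (≤-reflexive (sym (∑-filter _ tiles w)))
    } , ≤-trans (≤-reflexive (sym (∑-1* w)))
          (≤-trans (atMost-sat (λ _ → 1#) (here ≡-refl)) (≤-reflexive 1*v+0))
    where
    atLeast-sat : ∀ r {b} → atLeast r b ∈ program → b ≤ totalWeight r w
    atLeast-sat r p∈ = 0≤-⇒≤ (≤-trans (constraints F p∈) (≤-reflexive (value-atLeast r _ w v)))
    atMost-sat : ∀ r {s b} → atMost r s b ∈ program → totalWeight r w ≤ s * v + b
    atMost-sat r p∈ = 0≤-⇒≤ (≤-trans (constraints F p∈) (≤-reflexive (value-atMost r _ _ w v)))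

  optimalPartition :
    (∃ λ w → IsFractionalPartition f ℰ w ×
             (∀ {w′} → IsFractionalPartition f ℰ w′ → ∑ tiles w ≤ ∑ tiles w′)) ⊎
    (∀ {w} → ¬ IsFractionalPartition f ℰ w)
  optimalPartition with minimise (allTiles-unique m n k) program
  ... | inj₂ none = inj₂ (none ∘ partition⇒feasible)
  ... | inj₁ (w , v , F , least) =
    let P , ∑w≤v = feasible⇒partition F
    in inj₁ (w , P , λ P′ → ≤-trans ∑w≤v (least (partition⇒feasible P′)))

-- The worst input distribution for a pseudotranscript

module Information {c ℓ₁ ℓ₂} (ℝ : CompleteOrderedField c ℓ₁ ℓ₂)
                   (log : CompleteOrderedField.Carrier ℝ → CompleteOrderedField.Carrier ℝ)
                   (isLog₂ : IsLog₂ ℝ log)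
                   {m n k : ℕ} (x₀ : Fin m) (y₀ : Fin n)
                   where

  open OrderedField ℝ log
  open Series ℝ log
  open IsLog₂ isLog₂
  open Relation.Binary.Construct.Add.Supremum.Equality _≈_ using ([_]; ≈⁺-refl)
  open Relation.Binary.Construct.Add.Supremum.NonStrict _≤_ using ([_]; _≤⊤⁺)
  open Data.List.Extrema (DecTotalOrder.totalOrder decTotalOrder)
    using (max≤v⁺; ⊥≤max; xs≤max)

  inputCount : Carrier
  inputCount = ∑ (inputs m n) (λ _ → 1#)

  0<inputCount : 0# < inputCount
  0<inputCount = <-≤-trans 0<1 (term≤∑ (λ _ → 0≤1) (inputs-complete (x₀ , y₀)))

  uniform : Fin m × Fin n → Carrier
  uniform _ = proj₁ (reciprocal 0<inputCount)

  ∑-uniform : ∑ (inputs m n) uniform ≈ 1#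
  ∑-uniform = begin
    ∑ (inputs m n) uniform              ≈⟨ ∑-cong (inputs m n) (λ _ → sym (*-identityˡ _)) ⟩
    ∑ (inputs m n) (λ _ → 1# * r)       ≈⟨ ∑-*ʳ (inputs m n) r _ ⟩
    inputCount * r                      ≈⟨ proj₂ (proj₂ (reciprocal 0<inputCount)) ⟩
    1#                                  ∎
    where
    open ≈-Reasoning
    r = proj₁ (reciprocal 0<inputCount)

  uniform-isDistribution : IsDistribution {m} {n} {k} uniform
  uniform-isDistribution = (λ _ → proj₁ (proj₂ (reciprocal 0<inputCount))) , ∑-uniform

  0<uniform : ∀ xy → 0# < uniform xy
  0<uniform _ = proj₁ (proj₂ (reciprocal 0<inputCount)) ,
    λ 0≈r → 0≉1 (trans (sym (zeroʳ _))
      (trans (*-congˡ 0≈r) (proj₂ (proj₂ (reciprocal 0<inputCount)))))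

  module _ (Q : Pseudotranscript m n k) where
    open Pseudotranscript Q

    prob-nonNeg : ∀ q x y → 0# ≤ prob q x y
    prob-nonNeg q x y =
      let α , β , 0≤α , 0≤β , prob≈αβ = factors
      in ≤-trans (*-nonNeg (0≤α q x) (0≤β q y)) (≤-reflexive (sym (prob≈αβ q x y)))

    supportProbs : (Fin m × Fin n → Carrier) → Alphabet → List Carrier
    supportProbs p q = map (λ (x , y) → prob q x y) (filter (λ xy → 0# <? p xy) (inputs m n))

    maxOverSupport≤ : ∀ p q {b} → 0# ≤ b → (∀ x y → prob q x y ≤ b) → maxOverSupport p Q q ≤ b
    maxOverSupport≤ p q 0≤b prob≤b =
      max≤v⁺ {xs = supportProbs p q} 0≤b (All.map⁺ (All.tabulate λ { {x , y} _ → prob≤b x y }))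

    prob≤maxOverSupport : ∀ p q {x y} → 0# < p (x , y) → prob q x y ≤ maxOverSupport p Q q
    prob≤maxOverSupport p q {x} {y} 0<p = All.lookup (xs≤max 0# (supportProbs p q))
      (∈-map⁺ _ (∈-filter⁺ (λ xy → 0# <? p xy) (inputs-complete (x , y)) 0<p))

    -- The uniform distribution has full support, so this is the maximum of `prob q` over all
    -- inputs.
    peak : Alphabet → Carrier
    peak = maxOverSupport uniform Q

    prob≤peak : ∀ q x y → prob q x y ≤ peak q
    prob≤peak q x y = prob≤maxOverSupport uniform q (0<uniform (x , y))

    0≤peak : ∀ q → 0# ≤ peak q
    0≤peak q = ⊥≤max 0# (supportProbs uniform q)

    maxOverSupport≤peak : ∀ p q → maxOverSupport p Q q ≤ peak q
    maxOverSupport≤peak p q = maxOverSupport≤ p q (0≤peak q) (prob≤peak q)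

    peak≤∑prob : ∀ q → peak q ≤ ∑ (inputs m n) (λ (x , y) → prob q x y)
    peak≤∑prob q = maxOverSupport≤ uniform q (∑-nonNeg (inputs m n) λ (x , y) → prob-nonNeg q x y)
      λ x y → term≤∑ (λ (x , y) → prob-nonNeg q x y) (inputs-complete (x , y))

    peak-sum : ∃ (HasSum peak)
    peak-sum = bounded⇒HasSum {b = inputCount} λ as as! → begin
      ∑ as peak
        ≤⟨ ∑-mono as (λ {q} _ → peak≤∑prob q) ⟩
      ∑ as (λ q → ∑ (inputs m n) (λ (x , y) → prob q x y))
        ≈⟨ ∑-swap as (inputs m n) (λ q (x , y) → prob q x y) ⟩
      ∑ (inputs m n) (λ (x , y) → ∑ as (λ q → prob q x y))
        ≤⟨ ∑-mono (inputs m n) (λ { {x , y} _ → proj₁ (IsSum⇒HasSum (sum≡1 x y)) as as! }) ⟩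
      inputCount ∎
      where open ≤-Reasoning

    support-nonempty : ∀ {p} → IsDistribution {m} {n} {k} p → ∃₂ λ x y → 0# < p (x , y)
    support-nonempty (_ , ∑p≈1) =
      let (x , y) , _ , 0<p = 0<∑⇒∃0< (inputs m n) (<-≤-trans 0<1 (≤-reflexive (sym ∑p≈1)))
      in x , y , 0<p

    -- Secures the positivity that `log-mono` demands: the maximum over the support dominates the
    -- probabilities for one supported input, which already total 1.
    1≤sum : ∀ {p s} → IsDistribution {m} {n} {k} p → HasSum (maxOverSupport p Q) s → 1# ≤ s
    1≤sum {p} dist sum =
      let x , y , 0<p = support-nonempty dist
      in HasSum-mono (λ q → prob≤maxOverSupport p q 0<p) (IsSum⇒HasSum (sum≡1 x y)) sum

    -- A distribution influences `maxOverSupport` only through its support, and enlarging the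
    -- support can only raise the maximum.
    peak-isMaxI∞ : ∀ {s} → HasSum peak s → IsMaxI∞ Q [ log s ]
    peak-isMaxI∞ {s} sum =
      (uniform , uniform-isDistribution , [ s ] , HasSum⇒IsSum sum , ≈⁺-refl refl) ,
      λ { (p , dist , s′ , isSum , v≈) → ≤⁺-respˡ v≈ (bound p dist s′ isSum) }
      where
      bound : ∀ p → IsDistribution {m} {n} {k} p →
              ∀ s′ → IsSum (maxOverSupport p Q) s′ → log⁺ s′ ≤⁺ [ log s ]
      bound p dist s′ isSum
        with s′ | isSum | IsSum⇒≤ isSum (λ as as! →
               ≤-trans (∑-mono as λ {q} _ → maxOverSupport≤peak p q) (proj₁ sum as as!))
      -- The case `⊤⁺` cannot arise, the total being bounded by the finite `s`.
      ... | [ t ] | isSum | [ t≤s ] =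
        [ log-mono (<-≤-trans 0<1 (1≤sum dist (IsSum⇒HasSum isSum))) t≤s ]

-- From a pseudotranscript to a fractional partition

module FromPseudotranscript {c ℓ₁ ℓ₂} (ℝ : CompleteOrderedField c ℓ₁ ℓ₂)
  (log : CompleteOrderedField.Carrier ℝ → CompleteOrderedField.Carrier ℝ)
  (isLog₂ : IsLog₂ ℝ log)
  {m n k : ℕ} (x₀ : Fin m) (y₀ : Fin n)
  (f : Fin m → Fin n → Subset k)
  (ℰ : Fin m → Fin n → CompleteOrderedField.Carrier ℝ)
  (Q : Complexity.Pseudotranscript ℝ log m n k)
  (err≤ℰ : Complexity.ErrorAtMost ℝ log f ℰ Q)
  where

  open OrderedField ℝ log
  open Solver using (solve; _:=_; _:+_; _:*_)
  open Series ℝ log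
  open Rounding ℝ log
  open Information ℝ log isLog₂ {m} {n} {k} x₀ y₀
  open Partition ℝ log f ℰ using (tiles)
  open Data.List.Extrema (DecTotalOrder.totalOrder decTotalOrder)
    using (⊥≤max; xs≤max; argmax-sel)
  open Algebra.Construct.NaturalChoice.Min (DecTotalOrder.totalOrder decTotalOrder)
    using (_⊓_; x⊓y≤x; x⊓y≤y; x≤y⇒x⊓y≈x; ⊓-glb)
  open Pseudotranscript Q

  module _ {l} (g : Fin l → Carrier) where

    maximum : Carrier
    maximum = max 0# (map g (allFin l))

    0≤maximum : 0# ≤ maximum
    0≤maximum = ⊥≤max 0# (map g (allFin l))

    ≤maximum : ∀ i → g i ≤ maximum
    ≤maximum i = All.lookup (xs≤max 0# (map g (allFin l))) (∈-map⁺ g (∈-allFin i))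

    maximum-attained : maximum ≡ 0# ⊎ ∃ λ i → maximum ≡ g i
    maximum-attained with argmax-sel id 0# (map g (allFin l))
    ... | inj₁ max≡0 = inj₁ max≡0
    ... | inj₂ max∈ with ∈-map⁻ g max∈
    ... | i , _ , max≡gi = inj₂ (i , max≡gi)

  α : Alphabet → Fin m → Carrier
  α = proj₁ factors

  β : Alphabet → Fin n → Carrier
  β = proj₁ (proj₂ factors)

  prob≈αβ : ∀ q x y → prob q x y ≈ α q x * β q y
  prob≈αβ = proj₂ (proj₂ (proj₂ (proj₂ factors)))

  normal-α : ∀ q x → ∃ λ a → (0# ≤ a × a ≤ 1#) × α q x ≈ maximum (α q) * a
  normal-α q x = normalise (proj₁ (proj₂ (proj₂ factors)) q x) (≤maximum (α q) x)

  normal-β : ∀ q y → ∃ λ b → (0# ≤ b × b ≤ 1#) × β q y ≈ maximum (β q) * b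
  normal-β q y = normalise (proj₁ (proj₂ (proj₂ (proj₂ factors))) q y) (≤maximum (β q) y)

  a : Alphabet → Fin m → Carrier
  a q x = proj₁ (normal-α q x)

  b : Alphabet → Fin n → Carrier
  b q y = proj₁ (normal-β q y)

  scale : Alphabet → Carrier
  scale q = maximum (α q) * maximum (β q)

  -- The factors attain their maxima at some `x` and some `y` separately, and every such pair is an
  -- input, so the product of the maxima is itself a probability of `q`. A maximum equal to the
  -- starting value 0 makes the scale vanish.
  scale≤peak : ∀ q → scale q ≤ peak Q q
  scale≤peak q with maximum-attained (α q) | maximum-attained (β q)
  ... | inj₁ max≡0 | _ =
    ≤-trans (≤-reflexive (trans (*-congʳ (reflexive max≡0)) (zeroˡ _))) (0≤peak Q q)
  ... | inj₂ _ | inj₁ max≡0 =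
    ≤-trans (≤-reflexive (trans (*-congˡ (reflexive max≡0)) (zeroʳ _))) (0≤peak Q q)
  ... | inj₂ (x , max≡αx) | inj₂ (y , max≡βy) =
    ≤-trans (≤-reflexive (trans (*-cong (reflexive max≡αx) (reflexive max≡βy))
                                (sym (prob≈αβ q x y))))
            (prob≤peak Q q x y)

  part : Alphabet → Tile m n k → Carrier
  part q = tileWeight (scale q) (a q) (b q) (output q)

  0≤part : ∀ q t → 0# ≤ part q t
  0≤part q = tileWeight-nonNeg (scale q) (a q) (b q) (output q)
    (*-nonNeg (0≤maximum (α q)) (0≤maximum (β q)))
    (proj₁ ∘ proj₂ ∘ normal-α q) (proj₁ ∘ proj₂ ∘ normal-β q)

  ∑-part≤peak : ∀ q → ∑ tiles (part q) ≤ peak Q q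
  ∑-part≤peak q =
    ≤-trans (≤-reflexive (∑-tileWeight (scale q) (a q) (b q) (output q))) (scale≤peak q)

  scaled-prob : ∀ q x y → scale q * (a q x * b q y) ≈ prob q x y
  scaled-prob q x y = begin
    (A * B) * (a q x * b q y)
      ≈⟨ solve 4 (λ A B a b → (A :* B) :* (a :* b) := (A :* a) :* (B :* b)) refl
           A B (a q x) (b q y) ⟩
    (A * a q x) * (B * b q y)
      ≈⟨ *-cong (proj₂ (proj₂ (normal-α q x))) (proj₂ (proj₂ (normal-β q y))) ⟨
    α q x * β q y
      ≈⟨ prob≈αβ q x y ⟨
    prob q x y ∎
    where
    open ≈-Reasoning
    A = maximum (α q)
    B = maximum (β q)

  covering : Fin m → Fin n → List (Tile m n k)
  covering x y = filter ((x , y) ∈ₜ?_) tiles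

  good? : ∀ x y t → Dec _
  good? x y t = ((x , y) ∈ₜ? t) ×-dec (label t ∈? f x y)

  good : Fin m → Fin n → List (Tile m n k)
  good x y = filter (good? x y) tiles

  ∑-part-covering : ∀ q x y → ∑ (covering x y) (part q) ≈ prob q x y
  ∑-part-covering q x y = trans (∑-filter _ tiles _)
    (trans (∑-tileWeight-∋ (scale q) (a q) (b q) (output q) x y) (scaled-prob q x y))

  ∑-part-good : ∀ q x y → ∑ (good x y) (part q) ≈ prob q x y * indicator (does (output q ∈? f x y))
  ∑-part-good q x y = trans (∑-filter _ tiles _)
    (trans (∑-tileWeight-∋-labelled (scale q) (a q) (b q) (output q) x y (f x y))
      (trans (sym (*-assoc _ _ _)) (*-congʳ (scaled-prob q x y))))

  -- Countability supplies the decidable equality of symbols by which `HasSum-∑` merges finite lists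
  -- of them.
  _≟ₐ_ : DecidableEquality Alphabet
  _≟ₐ_ = via-injection countable ℕ._≟_

  module _ {s} (peak-hasSum : HasSum (peak Q) s) where

    part-sum : ∀ t → ∃ (HasSum (λ q → part q t))
    part-sum t = bounded⇒HasSum λ as as! → ≤-trans
      (∑-mono as λ {q} _ → ≤-trans (term≤∑ (0≤part q) (allTiles-complete t)) (∑-part≤peak q))
      (proj₁ peak-hasSum as as!)

    W : Tile m n k → Carrier
    W t = proj₁ (part-sum t)

    -- Truncation only affects tiles that cover no input.
    weight : Tile m n k → Carrier
    weight t = W t ⊓ 1#

    W-nonNeg : ∀ t → 0# ≤ W t
    W-nonNeg t = sum-nonNeg (proj₂ (part-sum t))

    -- The exchange of a finite sum over tiles with the series over symbols. Coverage, correctness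
    -- and total weight of `W` are read off from it for three choices of `ts`.
    ∑-parts : ∀ ts → HasSum (λ q → ∑ ts (part q)) (∑ ts W)
    ∑-parts ts = HasSum-∑ _≟ₐ_ ts 0≤part (λ t → proj₂ (part-sum t))

    ∑-W-covering : ∀ x y → ∑ (covering x y) W ≈ 1#
    ∑-W-covering x y = HasSum-unique
      (HasSum-resp (λ q → ∑-part-covering q x y) (∑-parts (covering x y)))
      (IsSum⇒HasSum (sum≡1 x y))

    -- A tile containing an input contributes one term to a nonnegative sum equal to 1, so `W t` is
    -- already at most 1.
    weight≈W : ∀ x y {t} → (x , y) ∈ₜ t → weight t ≈ W t
    weight≈W x y {t} xy∈t = x≤y⇒x⊓y≈x (≤-trans
      (term≤∑ W-nonNeg (∈-filter⁺ ((x , y) ∈ₜ?_) (allTiles-complete t) xy∈t))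
      (≤-reflexive (∑-W-covering x y)))

    -- Stated additively so that wrong and right symbols can be bounded on each partial sum, without
    -- subtracting one series from another.
    1≤ℰ+∑-W-good : ∀ x y → 1# ≤ ℰ x y + ∑ (good x y) W
    1≤ℰ+∑-W-good x y = proj₂ (IsSum⇒HasSum (sum≡1 x y)) λ as as! → begin
      ∑ as (λ q → prob q x y)
        ≈⟨ ∑-cong as (λ {q} _ → split (does (output q ∈? f x y)) (prob q x y)) ⟩
      ∑ as (λ q → wrong q + right q)
        ≈⟨ ∑-+ as wrong right ⟩
      ∑ as wrong + ∑ as right
        ≤⟨ +-mono-≤ (IsSum⇒partialSums≤ (proj₁ (proj₂ (err≤ℰ x y)))
                                        (proj₂ (proj₂ (err≤ℰ x y))) as as!)
                    (proj₁ (HasSum-resp (λ q → ∑-part-good q x y) (∑-parts (good x y))) as as!) ⟩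
      ℰ x y + ∑ (good x y) W ∎
      where
      open ≤-Reasoning
      wrong right : Alphabet → Carrier
      wrong q = if does (output q ∈? f x y) then 0# else prob q x y
      right q = prob q x y * indicator (does (output q ∈? f x y))
      split : ∀ b p → p ≈ (if b then 0# else p) + p * indicator b
      split true  p = sym (trans (+-identityˡ _) (*-identityʳ p))
      split false p = sym (trans (+-congˡ (zeroʳ p)) (+-identityʳ p))

    weight-isFractionalPartition : IsFractionalPartition f ℰ weight
    weight-isFractionalPartition = record
      { nonNeg = λ t → ⊓-glb (W-nonNeg t) 0≤1
      ; ≤1     = λ t → x⊓y≤y (W t) 1#
      ; cover  = λ x y → trans
          (∑-cong (covering x y) λ {t} t∈ →
            weight≈W x y {t} (proj₂ (∈-filter⁻ ((x , y) ∈ₜ?_) {xs = tiles} t∈)))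
          (∑-W-covering x y)
      ; error  = λ x y → ≤-trans
          (≤-trans (≤-reflexive (+-comm 1# _)) (≤-trans (+-monoʳ-≤ _ (1≤ℰ+∑-W-good x y))
            (≤-reflexive (trans (sym (+-assoc _ _ _))
              (trans (+-congʳ (-‿inverseˡ _)) (+-identityˡ _))))))
          (≤-reflexive (∑-cong (good x y) λ {t} t∈ →
            sym (weight≈W x y {t} (proj₁ (proj₂ (∈-filter⁻ (good? x y) {xs = tiles} t∈))))))
      }

    ∑-weight≤ : ∑ tiles weight ≤ s
    ∑-weight≤ = ≤-trans (∑-mono tiles λ {t} _ → x⊓y≤x (W t) 1#)
      (HasSum-mono ∑-part≤peak (∑-parts tiles) peak-hasSum)

-- From a fractional partition to a pseudotranscript

module FromPartition {c ℓ₁ ℓ₂} (ℝ : CompleteOrderedField c ℓ₁ ℓ₂)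
  (log : CompleteOrderedField.Carrier ℝ → CompleteOrderedField.Carrier ℝ)
  (isLog₂ : IsLog₂ ℝ log)
  {m n k : ℕ} (x₀ : Fin m) (y₀ : Fin n)
  (f : Fin m → Fin n → Subset k)
  (ℰ : Fin m → Fin n → CompleteOrderedField.Carrier ℝ)
  {w : Tile m n k → CompleteOrderedField.Carrier ℝ} 
  (P : Complexity.IsFractionalPartition ℝ log f ℰ w)
  where

  open OrderedField ℝ log
  open Series ℝ log
  open Information ℝ log isLog₂ {m} {n} {k} x₀ y₀
  open Partition ℝ log f ℰ using (tiles)
  open IsFractionalPartition P
  open Relation.Binary.Construct.Add.Supremum.NonStrict _≤_ using ([_])

  probₜ : Tile m n k → Fin m → Fin n → Carrier
  probₜ t x y = indicator (does ((x , y) ∈ₜ? t)) * w t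

  0≤probₜ : ∀ x y t → 0# ≤ probₜ t x y
  0≤probₜ x y t = *-nonNeg (indicator-nonNeg (does ((x , y) ∈ₜ? t))) (nonNeg t)

  ∑-probₜ : ∀ x y → ∑ tiles (λ t → probₜ t x y) ≈ 1#
  ∑-probₜ x y = trans (sym (∑-filter ((x , y) ∈ₜ?_) tiles w)) (cover x y)

  tiles-HasSum : ∀ {g : Tile m n k → Carrier} → (∀ t → 0# ≤ g t) → HasSum g (∑ tiles g)
  tiles-HasSum 0≤g = finite⇒HasSum 0≤g (allTiles-unique m n k) allTiles-complete

  transcript : Pseudotranscript m n k
  transcript = record
    { Alphabet  = Tile m n k
    ; countable = tile↣ℕ
    ; prob      = probₜ
    ; sum≡1     = λ x y → HasSum⇒IsSum (HasSum-respʳ (∑-probₜ x y) (tiles-HasSum (0≤probₜ x y)))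
    ; factors   =
        -- Membership in a rectangle is a product of two indicators; the weight of the tile is
        -- assigned to the second factor.
        (λ ((X , _) , _) x → indicator (does (x ∈? X))) ,
        (λ t@((_ , Y) , _) y → indicator (does (y ∈? Y)) * w t) ,
        (λ ((X , _) , _) x → indicator-nonNeg (does (x ∈? X))) ,
        (λ t@((_ , Y) , _) y → *-nonNeg (indicator-nonNeg (does (y ∈? Y))) (nonNeg t)) ,
        (λ ((X , Y) , _) x y →
          trans (*-congʳ (indicator-∧ (does (x ∈? X)) (does (y ∈? Y)))) (*-assoc _ _ _))
    ; output    = label
    }

  transcript-error : ErrorAtMost f ℰ transcript
  transcript-error x y = [ ∑ tiles wrong ] , HasSum⇒IsSum (tiles-HasSum 0≤wrong) ,
    -- The right tiles weigh at least `1# - ℰ x y`, and right and wrong tiles together weigh 1.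
    [ +-cancelˡ-≤ (1# - ℰ x y) (begin
      1# - ℰ x y + ∑ tiles wrong
        ≤⟨ +-mono-≤ (error x y) ≤-refl ⟩
      ∑ (filter _ tiles) w + ∑ tiles wrong
        ≈⟨ +-congʳ (∑-filter _ tiles w) ⟩
      ∑ tiles right + ∑ tiles wrong
        ≈⟨ ∑-+ tiles right wrong ⟨
      ∑ tiles (λ t → right t + wrong t)
        ≈⟨ ∑-cong tiles (λ {t} _ → merge (does ((x , y) ∈ₜ? t)) (does (label t ∈? f x y)) (w t)) ⟩
      ∑ tiles (λ t → probₜ t x y)
        ≈⟨ ∑-probₜ x y ⟩
      1#
        ≈⟨ trans (+-comm _ _) (x+[y-x]≈y (ℰ x y) 1#) ⟨
      1# - ℰ x y + ℰ x y ∎) ]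
    where
    open ≤-Reasoning
    wrong right : Tile m n k → Carrier
    wrong t = if does (label t ∈? f x y) then 0# else probₜ t x y
    right t = indicator (does ((x , y) ∈ₜ? t) ∧ does (label t ∈? f x y)) * w t
    0≤wrong : ∀ t → 0# ≤ wrong t
    0≤wrong t with does (label t ∈? f x y)
    ... | true  = ≤-refl
    ... | false = 0≤probₜ x y t
    merge : ∀ b b′ r →
      indicator (b ∧ b′) * r + (if b′ then 0# else indicator b * r) ≈ indicator b * r
    merge true  true  r = +-identityʳ _
    merge true  false r = trans (+-congʳ (zeroˡ r)) (+-identityˡ _)
    merge false true  r = +-identityʳ _
    merge false false r = trans (+-congʳ (zeroˡ r)) (+-identityˡ _)

  -- The peak of `t` is at most `w t`. Equality may fail: a tile with an empty side has peak 0
  -- whatever its weight.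
  peak-sum≤ : ∀ {s} → HasSum (peak transcript) s → s ≤ ∑ tiles w
  peak-sum≤ sum = HasSum-mono
    (λ t → maxOverSupport≤ transcript uniform t (nonNeg t)
       λ x y → indicator*≤ (does ((x , y) ∈ₜ? t)) (nonNeg t))
    sum (tiles-HasSum nonNeg)

  1≤∑w : 1# ≤ ∑ tiles w
  1≤∑w = ≤-trans (≤-reflexive (sym (cover x₀ y₀))) (∑-filter-≤ ((x₀ , y₀) ∈ₜ?_) tiles nonNeg)

-- Equality of the two optima

theorem2 : ∀ {c ℓ₁ ℓ₂} (ℝ : CompleteOrderedField c ℓ₁ ℓ₂) →
    let open CompleteOrderedField ℝ in
    (log : Carrier → Carrier) → IsLog₂ ℝ log →
    let open Complexity ℝ log in
    (m n k : ℕ) → .{{NonZero m}} → .{{NonZero n}} → .{{NonZero k}} →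
    (f : Fin m → Fin n → Subset k) (ℰ : Fin m → Fin n → Carrier) →
    (∀ x y → 0# ≤ ℰ x y × ℰ x y ≤ 1#) →
    ∃₂ λ pIC prt → IsPIC∞ f ℰ pIC × IsPrt f ℰ prt × pIC ≈⁺ log⁺ prt
theorem2 ℝ log isLog₂ m n k f ℰ _ = solution optimalPartition
  where
  x₀ : Fin m
  x₀ = fromℕ< (>-nonZero⁻¹ m)
  y₀ : Fin n
  y₀ = fromℕ< (>-nonZero⁻¹ n)

  open OrderedField ℝ log
  open Partition ℝ log f ℰ
  open Information ℝ log isLog₂ {m} {n} {k} x₀ y₀
  open IsLog₂ isLog₂ using (log-mono)
  open FromPseudotranscript ℝ log isLog₂ x₀ y₀ f ℰ
  open FromPartition ℝ log isLog₂ x₀ y₀ f ℰ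
  open Relation.Binary.Construct.Add.Supremum.Equality _≈_ using ([_]; ≈⁺-refl)
  open Relation.Binary.Construct.Add.Supremum.NonStrict _≤_
    using ([_]; _≤⊤⁺; ≤⁺-trans)

  solution :
    (∃ λ w → IsFractionalPartition f ℰ w ×
             (∀ {w′} → IsFractionalPartition f ℰ w′ → ∑ tiles w ≤ ∑ tiles w′)) ⊎
    (∀ {w} → ¬ IsFractionalPartition f ℰ w) →
    ∃₂ λ pIC prt → IsPIC∞ f ℰ pIC × IsPrt f ℰ prt × pIC ≈⁺ log⁺ prt
  -- An admissible pseudotranscript would round to a fractional partition, so the infimum ranges
  -- over the empty set.
  solution (inj₂ none) = ⊤⁺ , ⊤⁺ ,
    ((λ { (Q , err≤ℰ , _) →
         contradiction (weight-isFractionalPartition Q err≤ℰ (proj₂ (peak-sum Q))) none }) ,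
     λ _ → _ ≤⊤⁺) ,
    empty (λ { _ (_ , P , _) → none P }) ,
    ≈⁺-refl refl
  solution (inj₁ (w , P , least)) = [ log prt ] , [ prt ] ,
    (lowerBound , greatest) ,
    attained ((w , P , refl) , λ { (_ , P′ , v≈) → ≤-trans (least P′) (≤-reflexive (sym v≈)) }) ,
    ≈⁺-refl refl
    where
    prt = ∑ tiles w

    lowerBound : IsLowerBound _≤⁺_ (λ v → ∃ λ Q → ErrorAtMost f ℰ Q × IsMaxI∞ Q v) [ log prt ]
    lowerBound (Q , err≤ℰ , _ , upper) =
      let s , sum = peak-sum Q
          prt≤s   = ≤-trans (least (weight-isFractionalPartition Q err≤ℰ sum))
                            (∑-weight≤ Q err≤ℰ sum)
      in ≤⁺-trans ≤-trans [ log-mono (<-≤-trans 0<1 (1≤∑w P)) prt≤s ]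
                  -- The given value is the greatest over all distributions, hence at least the
                  -- value `log s` at the uniform one.
                  (upper (proj₁ (peak-isMaxI∞ Q sum)))

    greatest : ∀ {b} → IsLowerBound _≤⁺_ (λ v → ∃ λ Q → ErrorAtMost f ℰ Q × IsMaxI∞ Q v) b →
               b ≤⁺ [ log prt ]
    -- The pseudotranscript of the optimal partition has value at most `log prt`, so no lower bound
    -- can exceed it.
    greatest lower =
      let Q       = transcript P
          s , sum = peak-sum Q
      in ≤⁺-trans ≤-trans (lower (Q , transcript-error P , peak-isMaxI∞ Q sum))
           [ log-mono (<-≤-trans 0<1 (1≤sum Q uniform-isDistribution sum)) (peak-sum≤ P sum) ]
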